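{- Fix an integer $m\ge 3$ and let $C_{2m}$ be the cycle graph on $2m$ vertices. Then: (1) all groups $\mathrm{MH}_{k,l}(C_{2m})$ are torsion-free; (2) define $T:\mathbb Z\times\mathbb Z\to\mathbb Z$ by $T(k,l)=0$ if $k<0$ or $l<0$; $T(0,0)=2m$, $T(1,1)=4m$; and $T(k,l)=\max\{T(k-1,l-1),T(k-2,l-m)\}$ for all other $(k,l)$ (i.e. $k,l\ge 0$ and $(k,l)\ne(0,0),(1,1)$). Then $\operatorname{rk}\mathrm{MH}_{k,l}(C_{2m})=T(k,l)$ for all $k,l$.
   Context: For a finite simple undirected connected graph $G$, $d$ denotes the shortest-path metric on $V(G)$. For a tuple of vertices $(x_0,\ldots,x_k)$ put $\ell(x_0,\ldots,x_k)=\sum_{i=0}^{k-1} d(x_i,x_{i+1})$. The magnitude chain complex has $\mathrm{MC}_{k,l}(G)$ equal to the free abelian group on the tuples $(x_0,\ldots,x_k)\in V(G)^{k+1}$ with $x_i\neq x_{i+1}$ for all $i$ and $\ell(x_0,\ldots,x_k)=l$, with differential $\partial=\sum_{1\le i\le k-1}(-1)^i\partial_i:\mathrm{MC}_{k,l}(G)\to \mathrm{MC}_{k-1,l}(G)$, where $\partial_i(x_0,\ldots,x_k)=(x_0,\ldots,\hat x_i,\ldots,x_k)$ if $\ell(x_0,\ldots,\hat x_i,\ldots,x_k)=\ell(x_0,\ldots,x_k)$ and $0$ otherwise. Magnitude homology is $\mathrm{MH}_{k,l}(G)=H_k(\mathrm{MC}_{*,l}(G))$ (integer coefficients). -}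

module Defs where

open import Data.Bool using (Bool; true; false; _∧_; _∨_; not; if_then_else_)
open import Data.Nat using (ℕ; zero; suc; _≤?_; _∸_; _⊔_; _*_; _≡ᵇ_)
open import Data.Fin using (Fin; zero; suc; toℕ; inject₁; _≟_)
open import Data.Vec using (Vec; []; _∷_; removeAt)
open import Data.Vec.Properties using (≡-dec)
open import Data.List using (List; []; _∷_; map; concatMap; foldr; allFin)
open import Data.Bool.ListAction using (any)
open import Data.Integer using (ℤ; 0ℤ; 1ℤ; -_) renaming (_+_ to _+ℤ_; _*_ to _*ℤ_)
open import Data.Product using (Σ; _×_; ∃)
open import Data.Unit using (⊤)
open import Relation.Nullary using (¬_; yes; no)
open import Relation.Nullary.Decidable using (⌊_⌋)
open import Relation.Binary.PropositionalEquality using (_≡_)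

cycleAdj : (n : ℕ) → Fin n → Fin n → Bool
cycleAdj n i j = succ i j ∨ succ j i
  where
  succ : Fin n → Fin n → Bool
  succ a b = (toℕ b ≡ᵇ suc (toℕ a)) ∨ ((suc (toℕ a) ≡ᵇ n) ∧ (toℕ b ≡ᵇ 0))

sumℤ : List ℤ → ℤ
sumℤ = foldr _+ℤ_ 0ℤ

allVecs : (n k : ℕ) → List (Vec (Fin n) k)
allVecs n zero = [] ∷ []
allVecs n (suc k) = concatMap (λ v → map (λ x → x ∷ v) (allFin n)) (allVecs n k)

sgn : ℕ → ℤ
sgn zero = 1ℤ
sgn (suc i) = - sgn i

module MC (n : ℕ) (adj : Fin n → Fin n → Bool) where

  within : ℕ → Fin n → Fin n → Bool
  within zero x y = ⌊ x ≟ y ⌋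
  within (suc t) x y = within t x y ∨ any (λ z → within t x z ∧ adj z y) (allFin n)

  -- shortest-path distance: least t with y reachable within t steps
  -- (for a connected graph on n vertices such t ≤ n - 1 always exists)
  dist : Fin n → Fin n → ℕ
  dist x y = search n 0
    where
    search : ℕ → ℕ → ℕ
    search zero t = t
    search (suc f) t = if within t x y then t else search f (suc t)

  len : ∀ {k} → Vec (Fin n) k → ℕ
  len [] = 0
  len (x ∷ []) = 0
  len (x ∷ y ∷ xs) = dist x y + len (y ∷ xs)
    where open Data.Nat using (_+_)

  noRep : ∀ {k} → Vec (Fin n) k → Bool
  noRep [] = true
  noRep (x ∷ []) = true
  noRep (x ∷ y ∷ xs) = not ⌊ x ≟ y ⌋ ∧ noRep (y ∷ xs)

  gen : (k l : ℕ) → Vec (Fin n) (suc k) → Bool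
  gen k l x = noRep x ∧ (len x ≡ᵇ l)

  -- an integer chain on (k+1)-tuples; an element of MC_{k,l} is such a
  -- function supported on the generators of MC_{k,l}
  Chain : ℕ → Set
  Chain k = Vec (Fin n) (suc k) → ℤ

  Valid : (k l : ℕ) → Chain k → Set
  Valid k l c = ∀ x → gen k l x ≡ false → c x ≡ 0ℤ

  ∂ : (k l : ℕ) → Chain (suc k) → Chain k
  ∂ k l c y = sumℤ (map (λ x → sumℤ (map (λ j → term x j) (allFin k))) (allVecs n (suc (suc k))))
    where
    term : Vec (Fin n) (suc (suc k)) → Fin k → ℤ
    term x j =
      let i = suc (inject₁ j)
          f = removeAt x i
      in if gen (suc k) l x ∧ (len f ≡ᵇ len x) ∧ ⌊ ≡-dec _≟_ f y ⌋
         then sgn (suc (toℕ j)) *ℤ c x else 0ℤ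

  IsCycle : (k l : ℕ) → Chain k → Set
  IsCycle zero l c = Valid zero l c
  IsCycle (suc k) l c = Valid (suc k) l c × (∀ y → ∂ k l c y ≡ 0ℤ)

  IsBoundary : (k l : ℕ) → Chain k → Set
  IsBoundary k l c = Σ (Chain (suc k)) λ w → Valid (suc k) l w × (∀ y → ∂ k l w y ≡ c y)

  scale : ∀ {k} → ℤ → Chain k → Chain k
  scale a c y = a *ℤ c y

  lin : ∀ {k} r → (Fin r → ℤ) → (Fin r → Chain k) → Chain k
  lin r a z y = sumℤ (map (λ i → a i *ℤ z i y) (allFin r))

  MHTorsionFree : (k l : ℕ) → Set
  MHTorsionFree k l = ∀ (z : Chain k) → IsCycle k l z → ∀ (a : ℤ) → ¬ (a ≡ 0ℤ) →
                      IsBoundary k l (scale a z) → IsBoundary k l z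

  MHRank : (k l r : ℕ) → Set
  MHRank k l r =
    (Σ (Fin r → Chain k) λ z → (∀ i → IsCycle k l (z i)) ×
       (∀ a → IsBoundary k l (lin r a z) → ∀ i → a i ≡ 0ℤ))
    × (∀ (z : Fin (suc r) → Chain k) → (∀ i → IsCycle k l (z i)) →
       Σ (Fin (suc r) → ℤ) λ a → (∃ λ i → ¬ (a i ≡ 0ℤ)) × IsBoundary k l (lin (suc r) a z))

-- The function T of the theorem, restricted to k,l ≥ 0 (it is 0 otherwise).
-- down d f l = f (l - d) if l ≥ d, else 0  (i.e. value at negative l is 0)
down : ℕ → (ℕ → ℕ) → ℕ → ℕ
down d f l with d ≤? l
... | yes _ = f (l ∸ d)
... | no _ = 0

T : (m k l : ℕ) → ℕ
-- k = 0 : T(0,0) = 2m, otherwise max(T(-1,l-1), T(-2,l-m)) = 0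
T m zero zero = 2 * m
T m zero (suc l) = 0
-- k = 1 : T(1,1) = 4m, otherwise max(T(0,l-1), T(-1,l-m)) = T(0,l-1)
T m (suc zero) l = if l ≡ᵇ 1 then 4 * m else down 1 (T m zero) l
T m (suc (suc k)) l = down 1 (T m (suc k)) l ⊔ down m (T m k) l

{-# OPTIONS --safe #-}
module Submission where

-- Recording a tuple by its starting vertex and its successive displacements identifies the
-- magnitude complex of C_{2m} with 2m copies of the bar complex of Z[a,b]/(ab, a^m - b^m), where
-- a and b are the unit steps in the two directions and the antipodal step C is a^m = b^m.
--
-- Words whose first letter is a power of a, or C, span a subcomplex. It is contracted, by
-- splitting off a first unit step, onto the analogous subcomplex for b with one letter less, so
-- its homology is Z in each degree k, detected by the coefficient of the alternating word
-- a b a b ... of weight k. The full complex is the sum of the two one-sided subcomplexes, glued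
-- along the words starting with C. The connecting map E of this gluing lowers (k, l) by (2, m),
-- and weights show that everything splits: in degree k the homology has rank 2 in weight k from
-- the two alternating words, plus a copy of the homology in degree (k - 2, l - m).

open import Defs
open import Data.Bool using (Bool; true; false; not; if_then_else_; _∨_; _∧_) renaming (T to IsTrue)
open import Data.Bool.Properties using (T-∨; T-∧; T-≡; ∧-zeroʳ; not-involutive)
open import Data.Empty using (⊥-elim)
open import Data.Fin using (Fin; zero; suc; toℕ; fromℕ<; inject₁; punchIn; _≟_)
open import Data.Fin.Properties using (suc-injective; toℕ<n; toℕ-fromℕ<; toℕ-injective; any?; *↔×)
open import Data.Integer using (ℤ; 0ℤ; 1ℤ)
import Data.Integer as ℤ
open import Data.Integer.Tactic.RingSolver using (solve-∀)
open import Data.List using (List; []; _∷_; _++_; map; concatMap; allFin; applyUpTo)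
open import Data.List.Membership.Propositional using (lose)
open import Data.List.Membership.Propositional.Properties using (∈-allFin)
open import Data.List.Properties using (map-tabulate)
import Data.List.Relation.Unary.Any as Any
open import Data.List.Relation.Unary.Any.Properties using (any⁺; any⁻)
open import Data.Nat as ℕ using (ℕ; zero; suc; _∸_; _⊓_; _⊔_; _≤_; _<_; _≤?_; _≡ᵇ_; z≤n; s≤s; NonZero)
open import Data.Nat.DivMod using (_%_; _mod_; m%n<n; m%n%n≡m%n; [m+n]%n≡m%n; m<n⇒m%n≡m; n%n≡0; %-distribˡ-+)
import Data.Nat.Properties as ℕ
open import Data.Nat.Tactic.RingSolver using () renaming (solve-∀ to ℕ-solve-∀)
open import Data.Product using (Σ; ∃; _×_; _,_; proj₁; proj₂)
open import Data.Product.Function.NonDependent.Propositional using (_×-↔_)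
open import Data.Sum as Sum using (_⊎_; inj₁; inj₂)
open import Data.Unit using (⊤; tt)
open import Data.Vec using (Vec; []; _∷_; removeAt; insertAt)
open import Data.Vec.Functional using () renaming (insertAt to insertAtᶠ)
open import Data.Vec.Functional.Properties using (insertAt-lookup; insertAt-punchIn)
open import Data.Vec.Properties using (≡-dec)
open import Function using (_∘_; id)
open import Function.Bundles using (Equivalence; Inverse; _↔_; mk↔ₛ′)
open import Function.Properties.Inverse using (↔-refl; ↔-trans)
open import Relation.Binary using (tri<; tri≈; tri>)
open import Relation.Binary.PropositionalEquality
open import Relation.Nullary using (¬_; Dec; yes; no)
open import Relation.Nullary.Decidable using (⌊_⌋; ¬?; decidable-stable; fromWitness; toSum; toWitness)

open ≡-Reasoning

-- Both claims rest on one integral pairing. The index set `Idx k l` carries linear functionals `γ`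
-- that vanish on boundaries, together with cycles `ζ` dual to them, and a cycle of weight l killed
-- by all `γ` is a boundary. So homology embeds into a power of Z, which excludes torsion, and its
-- rank is the number of pairs (start vertex, index). No quotient group is formed: homology classes
-- are seen only through `γ`.
--
-- The recursion for T has a maximum where homology has a direct sum. The two agree because at most
-- one source contributes at a time: for l = k ≥ 1 only the alternating words, two for each start
-- vertex, hence 4m; for l ≠ k only classes lifted from degree k - 2, and there the first argument
-- of the maximum never exceeds the second. The hypothesis m ≥ 3 separates the sources: a class of
-- degree k + 2 lifted from degree k has weight at least m + k > k + 2.

-- Finite sums and linear dependence over the integers

module FiniteSums where

  open import Data.Integer using (_+_; _*_; -_; _-_)
  open import Data.Integer.Properties using (+-identityˡ; +-identityʳ; +-assoc; +-comm; *-zeroˡ; *-zeroʳ; *-distribˡ-+; neg-distrib-+; i*j≡0⇒i≡0∨j≡0)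

  Σ< : ℕ → (ℕ → ℤ) → ℤ
  Σ< p f = sumℤ (applyUpTo f p)

  Σ<-cong : ∀ p {f g} → (∀ j → j < p → f j ≡ g j) → Σ< p f ≡ Σ< p g
  Σ<-cong zero    h = refl
  Σ<-cong (suc p) h = cong₂ _+_ (h 0 (s≤s z≤n)) (Σ<-cong p λ j j<p → h (suc j) (s≤s j<p))

  Σ<-zero : ∀ p {f} → (∀ j → j < p → f j ≡ 0ℤ) → Σ< p f ≡ 0ℤ
  Σ<-zero zero    h = refl
  Σ<-zero (suc p) h = cong₂ _+_ (h 0 (s≤s z≤n)) (Σ<-zero p λ j j<p → h (suc j) (s≤s j<p))

  +-interchange : ∀ a b c d → (a + b) + (c + d) ≡ (a + c) + (b + d)
  +-interchange = solve-∀

  Σ<-+ : ∀ p f g → Σ< p (λ j → f j + g j) ≡ Σ< p f + Σ< p g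
  Σ<-+ zero    f g = refl
  Σ<-+ (suc p) f g =
    trans (cong (f 0 + g 0 +_) (Σ<-+ p (f ∘ suc) (g ∘ suc))) (+-interchange (f 0) (g 0) _ _)

  Σ<-* : ∀ p a f → Σ< p (λ j → a * f j) ≡ a * Σ< p f
  Σ<-* zero    a f = sym (*-zeroʳ a)
  Σ<-* (suc p) a f = trans (cong (a * f 0 +_) (Σ<-* p a (f ∘ suc))) (sym (*-distribˡ-+ a (f 0) _))

  Σ<-neg : ∀ p f → Σ< p (λ j → - f j) ≡ - Σ< p f
  Σ<-neg zero    f = refl
  Σ<-neg (suc p) f = trans (cong (- f 0 +_) (Σ<-neg p (f ∘ suc))) (sym (neg-distrib-+ (f 0) _))

  -- Both sides sum `F` over all (i, j, h) with i + j + h + 2 = p, that is, over the ways to cut p +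
  -- 1 steps into three letters; they differ in which cut is made first.
  Σ<-coassoc : ∀ p (F : ℕ → ℕ → ℕ → ℤ) →
    Σ< p (λ j → Σ< j (λ i → F i (j ∸ suc i) (p ∸ suc j)))
      ≡ Σ< p (λ i → Σ< (p ∸ suc i) (λ j → F i j (p ∸ suc i ∸ suc j)))
  Σ<-coassoc zero    F = refl
  Σ<-coassoc (suc p) F = begin
    0ℤ + Σ< p (λ j → F 0 j (p ∸ suc j) + Σ< j (λ i → F (suc i) (j ∸ suc i) (p ∸ suc j)))
      ≡⟨ +-identityˡ _ ⟩
    Σ< p (λ j → F 0 j (p ∸ suc j) + Σ< j (λ i → F (suc i) (j ∸ suc i) (p ∸ suc j)))
      ≡⟨ Σ<-+ p _ _ ⟩
    Σ< p (λ j → F 0 j (p ∸ suc j)) + Σ< p (λ j → Σ< j (λ i → F (suc i) (j ∸ suc i) (p ∸ suc j)))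
      ≡⟨ cong (Σ< p (λ j → F 0 j (p ∸ suc j)) +_) (Σ<-coassoc p (F ∘ suc)) ⟩
    Σ< p (λ j → F 0 j (p ∸ suc j)) + Σ< p (λ i → Σ< (p ∸ suc i) (λ j → F (suc i) j (p ∸ suc i ∸ suc j)))
      ∎

  Σ<-split : ∀ p q f → Σ< (p ℕ.+ q) f ≡ Σ< p f + Σ< q (λ j → f (p ℕ.+ j))
  Σ<-split zero    q f = sym (+-identityˡ _)
  Σ<-split (suc p) q f = trans (cong (f 0 +_) (Σ<-split p q (f ∘ suc))) (sym (+-assoc (f 0) _ _))

  Σ<-snoc : ∀ p f → Σ< (suc p) f ≡ Σ< p f + f p
  Σ<-snoc zero    f = +-comm (f 0) 0ℤ
  Σ<-snoc (suc p) f = trans (cong (f 0 +_) (Σ<-snoc p (f ∘ suc))) (sym (+-assoc (f 0) _ _))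

  Σ<-reverse : ∀ p f → Σ< p f ≡ Σ< p (λ j → f (p ∸ suc j))
  Σ<-reverse zero    f = refl
  Σ<-reverse (suc p) f = begin
    Σ< (suc p) f                          ≡⟨ Σ<-snoc p f ⟩
    Σ< p f + f p                          ≡⟨ +-comm _ (f p) ⟩
    f p + Σ< p f                          ≡⟨ cong (f p +_) (Σ<-reverse p f) ⟩
    f p + Σ< p (λ j → f (p ∸ suc j))      ∎

  Σ<-truncate : ∀ {p q} f → p ≤ q → (∀ j → p ≤ j → j < q → f j ≡ 0ℤ) → Σ< q f ≡ Σ< p f
  Σ<-truncate {zero}  {q}     f _         h = Σ<-zero q λ j → h j z≤n
  Σ<-truncate {suc p} {suc q} f (s≤s p≤q) h =
    cong (f 0 +_) (Σ<-truncate (f ∘ suc) p≤q λ j p≤j j<q → h (suc j) (s≤s p≤j) (s≤s j<q))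

  ΣL : ∀ {A : Set} → List A → (A → ℤ) → ℤ
  ΣL xs f = sumℤ (map f xs)

  module _ {A : Set} where

    ΣL-cong : ∀ (xs : List A) {f g} → (∀ x → f x ≡ g x) → ΣL xs f ≡ ΣL xs g
    ΣL-cong []       h = refl
    ΣL-cong (x ∷ xs) h = cong₂ _+_ (h x) (ΣL-cong xs h)

    ΣL-zero : ∀ (xs : List A) {f} → (∀ x → f x ≡ 0ℤ) → ΣL xs f ≡ 0ℤ
    ΣL-zero []       h = refl
    ΣL-zero (x ∷ xs) h = cong₂ _+_ (h x) (ΣL-zero xs h)

    ΣL-+ : ∀ (xs : List A) f g → ΣL xs (λ x → f x + g x) ≡ ΣL xs f + ΣL xs g
    ΣL-+ []       f g = refl
    ΣL-+ (x ∷ xs) f g = trans (cong (f x + g x +_) (ΣL-+ xs f g)) (+-interchange (f x) (g x) (ΣL xs f) (ΣL xs g))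

    ΣL-* : ∀ (xs : List A) a f → ΣL xs (λ x → a * f x) ≡ a * ΣL xs f
    ΣL-* []       a f = sym (*-zeroʳ a)
    ΣL-* (x ∷ xs) a f = trans (cong (a * f x +_) (ΣL-* xs a f)) (sym (*-distribˡ-+ a (f x) (ΣL xs f)))

    ΣL-neg : ∀ (xs : List A) f → ΣL xs (λ x → - f x) ≡ - ΣL xs f
    ΣL-neg []       f = refl
    ΣL-neg (x ∷ xs) f = trans (cong (- f x +_) (ΣL-neg xs f)) (sym (neg-distrib-+ (f x) (ΣL xs f)))

    ΣL-++ : ∀ (xs ys : List A) f → ΣL (xs ++ ys) f ≡ ΣL xs f + ΣL ys f
    ΣL-++ []       ys f = sym (+-identityˡ _)
    ΣL-++ (x ∷ xs) ys f = trans (cong (f x +_) (ΣL-++ xs ys f)) (sym (+-assoc (f x) _ _))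

  ΣL-comm : ∀ {A B : Set} (xs : List A) (ys : List B) (f : A → B → ℤ) →
    ΣL xs (λ x → ΣL ys (f x)) ≡ ΣL ys (λ y → ΣL xs (λ x → f x y))
  ΣL-comm []       ys f = sym (ΣL-zero ys λ _ → refl)
  ΣL-comm (x ∷ xs) ys f = trans (cong (ΣL ys (f x) +_) (ΣL-comm xs ys f))
    (sym (ΣL-+ ys (f x) (λ y → ΣL xs (λ x′ → f x′ y))))

  ΣL-map : ∀ {A B : Set} (g : A → B) xs f → ΣL (map g xs) f ≡ ΣL xs (f ∘ g)
  ΣL-map g []       f = refl
  ΣL-map g (x ∷ xs) f = cong (f (g x) +_) (ΣL-map g xs f)

  ΣL-concatMap : ∀ {A B : Set} (g : A → List B) xs f → ΣL (concatMap g xs) f ≡ ΣL xs (λ x → ΣL (g x) f)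
  ΣL-concatMap g []       f = refl
  ΣL-concatMap g (x ∷ xs) f = trans (ΣL-++ (g x) (concatMap g xs) f) (cong (ΣL (g x) f +_) (ΣL-concatMap g xs f))

  ΣF : ∀ n → (Fin n → ℤ) → ℤ
  ΣF n = ΣL (allFin n)

  ΣF-suc : ∀ n f → ΣF (suc n) f ≡ f zero + ΣF n (f ∘ suc)
  ΣF-suc n f = cong (λ xs → f zero + sumℤ xs)
    (trans (map-tabulate suc f) (sym (map-tabulate id (f ∘ suc))))

  when : Bool → ℤ → ℤ
  when b x = if b then x else 0ℤ

  when-0 : ∀ b → when b 0ℤ ≡ 0ℤ
  when-0 true  = refl
  when-0 false = refl

  when-Σ : ∀ {A : Set} (xs : List A) b f → ΣL xs (λ x → when b (f x)) ≡ when b (ΣL xs f)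
  when-Σ xs true  f = refl
  when-Σ xs false f = ΣL-zero xs λ _ → refl

  ⌊⌋-iff : ∀ {P Q : Set} (p : Dec P) (q : Dec Q) → (P → Q) → (Q → P) → ⌊ p ⌋ ≡ ⌊ q ⌋
  ⌊⌋-iff (yes p) (yes q) f g = refl
  ⌊⌋-iff (yes p) (no ¬q) f g = ⊥-elim (¬q (f p))
  ⌊⌋-iff (no ¬p) (yes q) f g = ⊥-elim (¬p (g q))
  ⌊⌋-iff (no ¬p) (no ¬q) f g = refl

  when-∧ : ∀ b b′ x → when (b ∧ b′) x ≡ when b (when b′ x)
  when-∧ true  b′ x = refl
  when-∧ false b′ x = refl

  ΣF-delta : ∀ n (j : Fin n) (f : Fin n → ℤ) → ΣF n (λ i → when ⌊ i ≟ j ⌋ (f i)) ≡ f j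
  ΣF-delta (suc n) zero f = trans (ΣF-suc n (λ i → when ⌊ i ≟ zero ⌋ (f i))) (trans (cong (f zero +_) (ΣL-zero (allFin n) λ _ → refl)) (+-identityʳ _))
  ΣF-delta (suc n) (suc j) f = trans (ΣF-suc n (λ i → when ⌊ i ≟ suc j ⌋ (f i))) (trans (+-identityˡ _)
    (trans (ΣL-cong (allFin n) λ i → cong (λ b → when b (f (suc i)))
        (⌊⌋-iff (suc i ≟ suc j) (i ≟ j) suc-injective (cong suc)))
      (ΣF-delta n j (f ∘ suc))))

  ΣF≡Σ< : ∀ n (f : ℕ → ℤ) → ΣF n (f ∘ toℕ) ≡ Σ< n f
  ΣF≡Σ< zero    f = refl
  ΣF≡Σ< (suc n) f = trans (ΣF-suc n (f ∘ toℕ)) (cong (f 0 +_) (ΣF≡Σ< n (f ∘ suc)))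

  ΣF-punchIn : ∀ n (p : Fin (suc n)) f → ΣF (suc n) f ≡ f p + ΣF n (f ∘ punchIn p)
  ΣF-punchIn n       zero    f = ΣF-suc n f
  ΣF-punchIn (suc n) (suc p) f = begin
    ΣF (suc (suc n)) f                                              ≡⟨ ΣF-suc (suc n) f ⟩
    f zero + ΣF (suc n) (f ∘ suc)                                   ≡⟨ cong (f zero +_) (ΣF-punchIn n p (f ∘ suc)) ⟩
    f zero + (f (suc p) + ΣF n (f ∘ suc ∘ punchIn p))               ≡⟨ alg (f zero) (f (suc p)) _ ⟩
    f (suc p) + (f zero + ΣF n (f ∘ suc ∘ punchIn p))               ≡⟨ cong (f (suc p) +_) (ΣF-suc n (f ∘ punchIn (suc p))) ⟨
    f (suc p) + ΣF (suc n) (f ∘ punchIn (suc p)) ∎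
    where
    alg : ∀ a b c → a + (b + c) ≡ b + (a + c)
    alg = solve-∀

  -- Gaussian elimination of the first coordinate.
  dependent : ∀ r (v : Fin (suc r) → Fin r → ℤ) → Σ (Fin (suc r) → ℤ) λ a →
    (∃ λ i → a i ≢ 0ℤ) × (∀ j → ΣF (suc r) (λ i → a i * v i j) ≡ 0ℤ)
  dependent zero v = (λ _ → 1ℤ) , (zero , λ ()) , λ ()
  dependent (suc r) v with any? (λ i → ¬? (v i zero ℤ.≟ 0ℤ))
  ... | no none with dependent r (λ i j → v (suc i) (suc j))
  ...   | a′ , (i , nz) , h = a , (suc i , nz) , eq
    where
    a : Fin (suc (suc r)) → ℤ
    a zero    = 0ℤ
    a (suc i) = a′ i
    v0 : ∀ i → v i zero ≡ 0ℤ
    v0 i = decidable-stable (v i zero ℤ.≟ 0ℤ) λ ne → none (i , ne)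
    eq : ∀ j → ΣF (suc (suc r)) (λ i → a i * v i j) ≡ 0ℤ
    eq zero    = ΣL-zero (allFin (suc (suc r))) λ i → trans (cong (a i *_) (v0 i)) (*-zeroʳ (a i))
    eq (suc j) = trans (ΣF-suc (suc r) (λ i → a i * v i (suc j))) (cong₂ _+_ (*-zeroˡ (v zero (suc j))) (h j))
  dependent (suc r) v | yes (p , pnz) with dependent r (λ i j → v p zero * v (punchIn p i) (suc j) - v (punchIn p i) zero * v p (suc j))
  ... | a′ , (i , nz) , h = a , (punchIn p i , anz) , eq
    where
    q : ℤ
    q = v p zero
    u : Fin (suc r) → Fin (suc r) → ℤ
    u i = v (punchIn p i)
    b : ℤ
    b = - ΣF (suc r) (λ i → a′ i * u i zero)
    a : Fin (suc (suc r)) → ℤ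
    a = insertAtᶠ (λ i → q * a′ i) p b
    anz : a (punchIn p i) ≢ 0ℤ
    anz e with i*j≡0⇒i≡0∨j≡0 q (trans (sym (insertAt-punchIn (λ i → q * a′ i) p b i)) e)
    ... | inj₁ q≡0 = pnz q≡0
    ... | inj₂ z   = nz z
    expand : ∀ j → ΣF (suc (suc r)) (λ i → a i * v i j) ≡ b * v p j + q * ΣF (suc r) (λ i → a′ i * u i j)
    expand j = trans (ΣF-punchIn (suc r) p (λ i → a i * v i j)) (cong₂ _+_
      (cong (_* v p j) (insertAt-lookup (λ i → q * a′ i) p b))
      (trans (ΣL-cong (allFin (suc r)) λ i → trans (cong (_* u i j) (insertAt-punchIn (λ i → q * a′ i) p b i)) (alg q (a′ i) (u i j)))
        (ΣL-* (allFin (suc r)) q (λ i → a′ i * u i j))))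
      where
      alg : ∀ x y z → x * y * z ≡ x * (y * z)
      alg = solve-∀
    eq : ∀ j → ΣF (suc (suc r)) (λ i → a i * v i j) ≡ 0ℤ
    eq zero = trans (expand zero) (alg (ΣF (suc r) (λ i → a′ i * u i zero)) q)
      where
      alg : ∀ x y → - x * y + y * x ≡ 0ℤ
      alg = solve-∀
    eq (suc j) = begin
      ΣF (suc (suc r)) (λ i → a i * v i (suc j))
        ≡⟨ expand (suc j) ⟩
      b * v p (suc j) + q * ΣF (suc r) (λ i → a′ i * u i (suc j))
        ≡⟨ alg₁ (ΣF (suc r) (λ i → a′ i * u i zero)) (v p (suc j)) q (ΣF (suc r) (λ i → a′ i * u i (suc j))) ⟩
      q * ΣF (suc r) (λ i → a′ i * u i (suc j)) + (- v p (suc j)) * ΣF (suc r) (λ i → a′ i * u i zero)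
        ≡⟨ cong₂ _+_ (ΣL-* (allFin (suc r)) q (λ i → a′ i * u i (suc j))) (ΣL-* (allFin (suc r)) (- v p (suc j)) (λ i → a′ i * u i zero)) ⟨
      ΣF (suc r) (λ i → q * (a′ i * u i (suc j))) + ΣF (suc r) (λ i → - v p (suc j) * (a′ i * u i zero))
        ≡⟨ ΣL-+ (allFin (suc r)) (λ i → q * (a′ i * u i (suc j))) (λ i → - v p (suc j) * (a′ i * u i zero)) ⟨
      ΣF (suc r) (λ i → q * (a′ i * u i (suc j)) + - v p (suc j) * (a′ i * u i zero))
        ≡⟨ ΣL-cong (allFin (suc r)) (λ i → alg₂ q (a′ i) (u i (suc j)) (v p (suc j)) (u i zero)) ⟩
      ΣF (suc r) (λ i → a′ i * (q * u i (suc j) - u i zero * v p (suc j)))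
        ≡⟨ h j ⟩
      0ℤ ∎
      where
      alg₁ : ∀ x y z w → - x * y + z * w ≡ z * w + - y * x
      alg₁ = solve-∀
      alg₂ : ∀ q a x y z → q * (a * x) + - y * (a * z) ≡ a * (q * x - z * y)
      alg₂ = solve-∀

open FiniteSums

-- The complex of words and its differential

module Words (N : ℕ) where

  open import Data.Integer using (_+_; _*_; -_)
  open import Data.Integer.Properties using (+-identityˡ; +-identityʳ; +-inverseʳ; +-comm; *-zeroˡ; *-zeroʳ; *-distribˡ-+; neg-distrib-+; neg-involutive)

  -- Here m = N + 2. The letter ℓ d i stands for i + 1 unit steps in direction d, and C for the
  -- antipodal step, that is, m unit steps in either direction.
  data Letter : Set where
    ℓ : Bool → ℕ → Letter
    C : Letter

  X : ℕ → Set
  X k = Vec Letter k → ℤ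

  infixl 6 _⊕_
  _⊕_ : ∀ {k} → X k → X k → X k
  (c ⊕ c′) w = c w + c′ w

  infixl 7 _⊙_
  _⊙_ : ∀ {k} → ℤ → X k → X k
  (a ⊙ c) w = a * c w

  ⊖_ : ∀ {k} → X k → X k
  (⊖ c) w = - c w

  𝟎 : ∀ {k} → X k
  𝟎 _ = 0ℤ

  infixl 8 _▹_
  _▹_ : ∀ {k} → X (suc k) → Letter → X k
  (c ▹ s) w = c (s ∷ w)

  alt : ∀ k → Bool → Vec Letter k
  alt zero    d = []
  alt (suc k) d = ℓ d 0 ∷ alt k (not d)

  M : ℕ
  M = suc N

  -- Letters ℓ d i with i ≥ m - 1 are junk: chains are only compared on good words.
  GoodL : Letter → Set
  GoodL (ℓ d i) = i < M
  GoodL C       = ⊤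

  Good : ∀ {k} → Vec Letter k → Set
  Good []      = ⊤
  Good (s ∷ w) = GoodL s × Good w

  wtL : Letter → ℕ
  wtL (ℓ d i) = suc i
  wtL C       = suc M

  wt : ∀ {k} → Vec Letter k → ℕ
  wt []      = 0
  wt (s ∷ w) = wtL s ℕ.+ wt w

  -- Runs over the splittings of p + 1 steps (not p) into two letters.
  S : ∀ {k} → Bool → ℕ → X (suc (suc k)) → X k
  S d p c w = Σ< p λ j → c (ℓ d j ∷ ℓ d (p ∸ suc j) ∷ w)

  spl : ∀ {k} → Letter → X (suc (suc k)) → X k
  spl (ℓ d i) c   = S d i c
  spl C       c w = S false M c w + S true M c w

  -- Chains are functions on words, so ∂ is evaluated by undoing mergers: the coefficient at w
  -- collects those of the words that have w as a face.
  ∂ : ∀ {k} → X (suc k) → X k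
  ∂ c []      = 0ℤ
  ∂ c (s ∷ w) = - (spl s c w + ∂ (c ▹ s) w)

  infix 4 _≈_
  _≈_ : ∀ {k} → X k → X k → Set
  c ≈ c′ = ∀ w → Good w → c w ≡ c′ w

  Cyc : ∀ {k} → X k → Set
  Cyc {zero}  c = ⊤
  Cyc {suc k} c = ∂ c ≈ 𝟎

  Bd : ∀ {k} → X k → Set
  Bd c = Σ (X _) λ u → ∂ u ≈ c

  spl-C : ∀ {k} d (c : X (suc (suc k))) w → spl C c w ≡ S d M c w + S (not d) M c w
  spl-C false c w = refl
  spl-C true  c w = +-comm (S false M c w) (S true M c w)

  S-⊕ : ∀ {k} d p (c c′ : X (suc (suc k))) w → S d p (c ⊕ c′) w ≡ S d p c w + S d p c′ w
  S-⊕ d p c c′ w = Σ<-+ p _ _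

  S-⊙ : ∀ {k} d p a (c : X (suc (suc k))) w → S d p (a ⊙ c) w ≡ a * S d p c w
  S-⊙ d p a c w = Σ<-* p a _

  S-neg : ∀ {k} d p (c : X (suc (suc k))) w → S d p (⊖ c) w ≡ - S d p c w
  S-neg d p c w = Σ<-neg p _

  spl-⊕ : ∀ {k} s (c c′ : X (suc (suc k))) w → spl s (c ⊕ c′) w ≡ spl s c w + spl s c′ w
  spl-⊕ (ℓ d i) c c′ w = S-⊕ d i c c′ w
  spl-⊕ C       c c′ w =
    trans (cong₂ _+_ (S-⊕ false M c c′ w) (S-⊕ true M c c′ w))
          (+-interchange (S false M c w) (S false M c′ w) (S true M c w) (S true M c′ w))

  spl-⊙ : ∀ {k} s a (c : X (suc (suc k))) w → spl s (a ⊙ c) w ≡ a * spl s c w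
  spl-⊙ (ℓ d i) a c w = S-⊙ d i a c w
  spl-⊙ C       a c w =
    trans (cong₂ _+_ (S-⊙ false M a c w) (S-⊙ true M a c w))
          (sym (*-distribˡ-+ a (S false M c w) (S true M c w)))

  spl-neg : ∀ {k} s (c : X (suc (suc k))) w → spl s (⊖ c) w ≡ - spl s c w
  spl-neg (ℓ d i) c w = S-neg d i c w
  spl-neg C       c w =
    trans (cong₂ _+_ (S-neg false M c w) (S-neg true M c w))
          (sym (neg-distrib-+ (S false M c w) (S true M c w)))

  neg-+ : ∀ a b c d → - ((a + b) + (c + d)) ≡ - (a + c) + - (b + d)
  neg-+ = solve-∀

  neg-* : ∀ x a b → - (x * a + x * b) ≡ x * - (a + b)
  neg-* = solve-∀

  ∂-⊕ : ∀ {k} (c c′ : X (suc k)) w → ∂ (c ⊕ c′) w ≡ ∂ c w + ∂ c′ w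
  ∂-⊕ c c′ []      = refl
  ∂-⊕ c c′ (s ∷ w) =
    trans (cong -_ (cong₂ _+_ (spl-⊕ s c c′ w) (∂-⊕ (c ▹ s) (c′ ▹ s) w)))
          (neg-+ (spl s c w) (spl s c′ w) (∂ (c ▹ s) w) (∂ (c′ ▹ s) w))

  ∂-⊙ : ∀ {k} a (c : X (suc k)) w → ∂ (a ⊙ c) w ≡ a * ∂ c w
  ∂-⊙ a c []      = sym (*-zeroʳ a)
  ∂-⊙ a c (s ∷ w) =
    trans (cong -_ (cong₂ _+_ (spl-⊙ s a c w) (∂-⊙ a (c ▹ s) w)))
          (neg-* a (spl s c w) (∂ (c ▹ s) w))

  ∂-𝟎 : ∀ {k} w → ∂ (𝟎 {suc k}) w ≡ 0ℤ
  ∂-𝟎 w = trans (∂-⊙ 0ℤ 𝟎 w) (*-zeroˡ (∂ 𝟎 w))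

  ∂-Σ< : ∀ {k} p (c : ℕ → X (suc k)) w → ∂ (λ v → Σ< p λ j → c j v) w ≡ Σ< p (λ j → ∂ (c j) w)
  ∂-Σ< zero    c w = ∂-𝟎 w
  ∂-Σ< (suc p) c w = trans (∂-⊕ (c 0) _ w) (cong (∂ (c 0) w +_) (∂-Σ< p (c ∘ suc) w))

  wt-split : ∀ {p j} → j < p → suc j ℕ.+ suc (p ∸ suc j) ≡ suc p
  wt-split {p} {j} j<p = trans (ℕ.+-suc (suc j) (p ∸ suc j)) (cong suc (ℕ.m+[n∸m]≡n j<p))

  ∸-< : ∀ {p j} → j < p → p ∸ suc j < p
  ∸-< {suc p} {j} _ = s≤s (ℕ.m∸n≤m p j)

  -- Merging letters preserves weight, so `∂ c w` depends only on the values of c in weight `wt w`.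
  -- This form of congruence allows a chain to be cut down to one weight without disturbing its
  -- differential there.
  Agree : ∀ {k} → ℕ → X k → X k → Set
  Agree l c c′ = ∀ v → Good v → wt v ≡ l → c v ≡ c′ v

  S-cong : ∀ {k} d p {c c′ : X (suc (suc k))} {w} → p ≤ M → Good w →
    Agree (suc p ℕ.+ wt w) c c′ → S d p c w ≡ S d p c′ w
  S-cong d p {w = w} p≤M gw h = Σ<-cong p λ j j<p →
    h (ℓ d j ∷ ℓ d (p ∸ suc j) ∷ w)
      (ℕ.<-≤-trans j<p p≤M , ℕ.<-≤-trans (∸-< j<p) p≤M , gw)
      (trans (sym (ℕ.+-assoc (suc j) _ (wt w))) (cong (ℕ._+ wt w) (wt-split j<p)))

  spl-cong : ∀ {k} s {c c′ : X (suc (suc k))} {w} → GoodL s → Good w →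
    Agree (wtL s ℕ.+ wt w) c c′ → spl s c w ≡ spl s c′ w
  spl-cong (ℓ d i) gs gw h = S-cong d i (ℕ.<⇒≤ gs) gw h
  spl-cong C       gs gw h =
    cong₂ _+_ (S-cong false M ℕ.≤-refl gw h) (S-cong true M ℕ.≤-refl gw h)

  ∂-agree : ∀ {k} {c c′ : X (suc k)} w → Good w → Agree (wt w) c c′ → ∂ c w ≡ ∂ c′ w
  ∂-agree []      gw        h = refl
  ∂-agree {c = c} {c′} (s ∷ w) (gs , gw) h = cong -_ (cong₂ _+_
    (spl-cong s gs gw h)
    (∂-agree w gw λ v gv e → h (s ∷ v) (gs , gv) (cong (wtL s ℕ.+_) e)))

  ∂-cong : ∀ {k} {c c′ : X (suc k)} → c ≈ c′ → ∂ c ≈ ∂ c′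
  ∂-cong h w gw = ∂-agree w gw λ v gv _ → h v gv

  ∂-zero : ∀ {k} {c : X (suc k)} → c ≈ 𝟎 → ∂ c ≈ 𝟎
  ∂-zero h w gw = trans (∂-cong h w gw) (∂-𝟎 w)

  -- Splitting is coassociative, whence ∂ ∘ ∂ = 0.
  S-coassoc : ∀ {k} d p (c : X (suc (suc (suc k)))) w →
    Σ< p (λ j → S d j c (ℓ d (p ∸ suc j) ∷ w)) ≡ Σ< p (λ j → S d (p ∸ suc j) (c ▹ ℓ d j) w)
  S-coassoc d p c w = Σ<-coassoc p λ i j h → c (ℓ d i ∷ ℓ d j ∷ ℓ d h ∷ w)

  -- After a letter has been split in two, `∂` splits the first piece again (`A`), the second piece
  -- again (`B`), or a later letter (`D`). The first two kinds carry opposite signs and cancel by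
  -- coassociativity.
  S-∂ : ∀ {k} d p (c : X (suc (suc (suc k)))) w → S d p (∂ c) w ≡ ∂ (S d p c) w
  S-∂ d p c w = begin
    S d p (∂ c) w
      ≡⟨ Σ<-cong p (λ j _ → lem (S d j c (ℓ d (p ∸ suc j) ∷ w)) (S d (p ∸ suc j) (c ▹ ℓ d j) w) (∂ (c ▹ ℓ d j ▹ ℓ d (p ∸ suc j)) w)) ⟩
    Σ< p (λ j → (- A j + B j) + D j)
      ≡⟨ trans (Σ<-+ p (λ j → - A j + B j) D) (cong (_+ Σ< p D) (Σ<-+ p (λ j → - A j) B)) ⟩
    (Σ< p (λ j → - A j) + Σ< p B) + Σ< p D
      ≡⟨ cong (λ z → (z + Σ< p B) + Σ< p D) (trans (Σ<-neg p A) (cong -_ (S-coassoc d p c w))) ⟩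
    (- Σ< p B + Σ< p B) + Σ< p D
      ≡⟨ cancel (Σ< p B) (Σ< p D) ⟩
    Σ< p D
      ≡⟨ ∂-Σ< p (λ j → c ▹ ℓ d j ▹ ℓ d (p ∸ suc j)) w ⟨
    ∂ (S d p c) w ∎
    where
    A B D : ℕ → ℤ
    A j = S d j c (ℓ d (p ∸ suc j) ∷ w)
    B j = S d (p ∸ suc j) (c ▹ ℓ d j) w
    D j = ∂ (c ▹ ℓ d j ▹ ℓ d (p ∸ suc j)) w
    lem : ∀ a b e → - (a + - (b + e)) ≡ (- a + b) + e
    lem = solve-∀
    cancel : ∀ b e → (- b + b) + e ≡ e
    cancel = solve-∀

  spl-∂ : ∀ {k} s (c : X (suc (suc (suc k)))) w → spl s (∂ c) w ≡ ∂ (spl s c) w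
  spl-∂ (ℓ d i) c w = S-∂ d i c w
  spl-∂ C       c w =
    trans (cong₂ _+_ (S-∂ false M c w) (S-∂ true M c w)) (sym (∂-⊕ (S false M c) (S true M c) w))

  ∂-neg : ∀ {k} (c : X (suc k)) w → ∂ (⊖ c) w ≡ - ∂ c w
  ∂-neg c []      = refl
  ∂-neg c (s ∷ w) = cong -_
    (trans (cong₂ _+_ (spl-neg s c w) (∂-neg (c ▹ s) w)) (sym (neg-distrib-+ (spl s c w) (∂ (c ▹ s) w))))

  ∂∂ : ∀ {k} (c : X (suc (suc k))) w → ∂ (∂ c) w ≡ 0ℤ
  ∂∂ c []      = refl
  ∂∂ {suc k} c (s ∷ w) = begin
    - (spl s (∂ c) w + ∂ (λ v → - (spl s c v + ∂ (c ▹ s) v)) w)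
      ≡⟨ cong -_ (cong₂ _+_ (spl-∂ s c w) (trans (∂-neg (spl s c ⊕ ∂ (c ▹ s)) w) (cong -_ (∂-⊕ (spl s c) (∂ (c ▹ s)) w)))) ⟩
    - (∂ (spl s c) w + - (∂ (spl s c) w + ∂ (∂ (c ▹ s)) w))
      ≡⟨ cancel (∂ (spl s c) w) _ ⟩
    ∂ (∂ (c ▹ s)) w
      ≡⟨ ∂∂ (c ▹ s) w ⟩
    0ℤ ∎
    where
    cancel : ∀ a b → - (a + - (a + b)) ≡ b
    cancel = solve-∀

  -- One-sided subcomplexes and their contraction

  sel : Bool → Bool → ℤ → ℤ
  sel false false x = x
  sel true  true  x = x
  sel _     _     x = 0ℤ

  sel-same : ∀ d x → sel d d x ≡ x
  sel-same false x = refl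
  sel-same true  x = refl

  sel-not : ∀ d x → sel d (not d) x ≡ 0ℤ
  sel-not false x = refl
  sel-not true  x = refl

  same-or-not : ∀ d e → e ≡ d ⊎ e ≡ not d
  same-or-not false false = inj₁ refl
  same-or-not false true  = inj₂ refl
  same-or-not true  false = inj₂ refl
  same-or-not true  true  = inj₁ refl

  -- `Van (not d)` cuts out the one-sided subcomplex of d: what remains are words beginning with a
  -- power of d or with `C`.
  Van : ∀ {k} → Bool → X (suc k) → Set
  Van d c = ∀ j v → j < M → Good v → c (ℓ d j ∷ v) ≡ 0ℤ

  -- The letter d^(j + 2), which is C for j = N = m - 2.
  nxt : Bool → ℕ → Letter
  nxt d j with j ℕ.≟ N
  ... | yes _ = C
  ... | no  _ = ℓ d (suc j)

  nxt-< : ∀ d {j} → j < N → nxt d j ≡ ℓ d (suc j)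
  nxt-< d {j} j<N with j ℕ.≟ N
  ... | yes j≡N = ⊥-elim (ℕ.<⇒≢ j<N j≡N)
  ... | no  _   = refl

  nxt-N : ∀ d → nxt d N ≡ C
  nxt-N d with N ℕ.≟ N
  ... | yes _   = refl
  ... | no  N≢N = ⊥-elim (N≢N refl)

  -- Counting `C` as d^m arranges the letters on the side of d in a single sequence d, d^2, ...,
  -- d^m, so that `C` is just the last value of `nxt`.
  data View (d : Bool) : Letter → Set where
    first : View d (ℓ d 0)
    next  : ∀ j → j < M → View d (nxt d j)
    opp   : ∀ i → i < M → View d (ℓ (not d) i)

  view : ∀ d s → GoodL s → View d s
  view d (ℓ e i) g with same-or-not d e
  view d (ℓ e i)       g       | inj₂ refl = opp i g
  view d (ℓ e zero)    g       | inj₁ refl = first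
  view d (ℓ e (suc i)) (s≤s g) | inj₁ refl = subst (View d) (nxt-< d g) (next i (s≤s (ℕ.<⇒≤ g)))
  view d C g = subst (View d) (nxt-N d) (next N ℕ.≤-refl)

  S-van : ∀ {k} d p (c : X (suc (suc k))) {w} → p ≤ M → Good w → Van d c → S d p c w ≡ 0ℤ
  S-van d p c p≤M gw h = Σ<-zero p λ j j<p →
    h j _ (ℕ.<-≤-trans j<p p≤M) (ℕ.<-≤-trans (∸-< j<p) p≤M , gw)

  -- On a one-sided chain the splittings of `C` in the other direction contribute nothing, so `C`
  -- behaves exactly like the power d^m.
  spl-nxt : ∀ {k} d j {c : X (suc (suc k))} {w} → j < M → Good w → Van (not d) c →
    spl (nxt d j) c w ≡ S d (suc j) c w
  spl-nxt d j {c} {w} j<M gw h with j ℕ.≟ N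
  ... | no  _    = refl
  ... | yes refl = begin
    spl C c w                   ≡⟨ spl-C d c w ⟩
    S d M c w + S (not d) M c w ≡⟨ cong (S d M c w +_) (S-van (not d) M c ℕ.≤-refl gw h) ⟩
    S d M c w + 0ℤ              ≡⟨ +-identityʳ _ ⟩
    S d M c w                   ∎

  GoodL-nxt : ∀ d {j} → j < M → GoodL (nxt d j)
  GoodL-nxt d {j} (s≤s j≤N) with j ℕ.≟ N
  ... | yes _   = tt
  ... | no  j≢N = s≤s (ℕ.≤∧≢⇒< j≤N j≢N)

  -- Puts one unit step d in front. In the boundary this step either stays, leaving minus `∂ u`
  -- behind it, or merges with a leading power of d into the next power. It merges neither with
  -- opposite steps nor with `C`.
  pre : ∀ {k} → Bool → X k → X (suc k)
  pre d u (ℓ e zero    ∷ w) = sel d e (u w)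
  pre d u (ℓ e (suc _) ∷ w) = 0ℤ
  pre d u (C           ∷ w) = 0ℤ

  pre-van : ∀ {k} d (u : X k) → Van (not d) (pre d u)
  pre-van d u zero    v _ _ = sel-not d _
  pre-van d u (suc j) v _ _ = refl

  neg-0+ : ∀ a → - (0ℤ + a) ≡ - a
  neg-0+ = solve-∀

  neg-+0 : ∀ a → - ((a + 0ℤ) + 0ℤ) ≡ - a
  neg-+0 = solve-∀

  ∂-pre-first : ∀ {k} d (u : X (suc k)) {w} → Good w → ∂ (pre d u) (ℓ d 0 ∷ w) ≡ - ∂ u w
  ∂-pre-first d u {w} gw =
    trans (neg-0+ _) (cong -_ (∂-cong (λ v _ → sel-same d (u v)) w gw))

  ∂-pre-opp : ∀ {k} d (u : X (suc k)) {i w} → i < M → Good w → ∂ (pre d u) (ℓ (not d) i ∷ w) ≡ 0ℤ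
  ∂-pre-opp d u {i} {w} i<M gw = cong -_ (cong₂ _+_
    (S-van (not d) i (pre d u) (ℕ.<⇒≤ i<M) gw (pre-van d u))
    (∂-zero (λ v gv → pre-van d u i v i<M gv) w gw))

  ∂-pre-nxt : ∀ {k} d (u : X (suc k)) {j w} → j < M → Good w →
    ∂ (pre d u) (nxt d j ∷ w) ≡ - u (ℓ d j ∷ w)
  ∂-pre-nxt d u {j} {w} j<M gw = begin
    - (spl (nxt d j) (pre d u) w + ∂ (pre d u ▹ nxt d j) w)
      ≡⟨ cong -_ (cong₂ _+_ (spl-nxt d j j<M gw (pre-van d u)) (∂-zero pre-nxt w gw)) ⟩
    - (S d (suc j) (pre d u) w + 0ℤ)
      -- Of all splittings of d^(j + 2), only the one whose first piece is a unit step meets the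
      -- support of `pre d u`.
      ≡⟨ cong (λ z → - (z + 0ℤ)) (cong₂ _+_ (sel-same d _) (Σ<-zero j λ _ _ → refl)) ⟩
    - ((u (ℓ d j ∷ w) + 0ℤ) + 0ℤ)
      ≡⟨ neg-+0 _ ⟩
    - u (ℓ d j ∷ w) ∎
    where
    pre-nxt : pre d u ▹ nxt d j ≈ 𝟎
    pre-nxt v _ with j ℕ.≟ N
    ... | yes _ = refl
    ... | no  _ = refl

  -- Solves `∂ (pre d u) ≈ c` for u at the words beginning with some `nxt d j`; by `∂-pre-nxt` this
  -- dictates both the index and the sign.
  shift : ∀ {k} → Bool → X (suc k) → X (suc k)
  shift d c (ℓ e j ∷ w) = sel d e (- c (nxt d j ∷ w))
  shift d c (C     ∷ w) = 0ℤ

  neg≡0 : ∀ {a} → - a ≡ 0ℤ → a ≡ 0ℤ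
  neg≡0 {a} h = trans (sym (neg-involutive a)) (cong -_ h)

  module Reduce {k} (d : Bool) (c : X (suc k)) (van : Van (not d) c) where

    -- Modulo boundaries, c is x preceded by one step in direction d.
    x : X k
    x = (c ▹ ℓ d 0) ⊕ ∂ (shift d c)

    -- Subtracting the boundary of `pre d (shift d c)` from c leaves `pre d x`, and `⊖ pre d t`
    -- bounds that. Since t vanishes on words beginning with a power of d, the new step merges with
    -- nothing and the values already matched survive.
    finish : (t : X (suc k)) → Van d t → ∂ t ≈ x → Σ (X (suc (suc k))) λ u → Van (not d) u × ∂ u ≈ c
    finish t tvan ∂t = pre d u , pre-van d u , eq
      where
      u : X (suc k)
      u = shift d c ⊕ ⊖ t
      alg₁ : ∀ a b → - (a + - (b + a)) ≡ b
      alg₁ = solve-∀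
      alg₂ : ∀ a → - (- a + - 0ℤ) ≡ a
      alg₂ = solve-∀
      eq : ∂ (pre d u) ≈ c
      eq (s ∷ w) (gs , gw) with view d s gs
      ... | first = begin
        ∂ (pre d u) (ℓ d 0 ∷ w)               ≡⟨ ∂-pre-first d u gw ⟩
        - ∂ u w                               ≡⟨ cong -_ (∂-⊕ (shift d c) (⊖ t) w) ⟩
        - (∂ (shift d c) w + ∂ (⊖ t) w)       ≡⟨ cong (λ z → - (∂ (shift d c) w + z)) (trans (∂-neg t w) (cong -_ (∂t w gw))) ⟩
        - (∂ (shift d c) w + - (c (ℓ d 0 ∷ w) + ∂ (shift d c) w)) ≡⟨ alg₁ (∂ (shift d c) w) _ ⟩
        c (ℓ d 0 ∷ w) ∎
      ... | next j j<M = begin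
        ∂ (pre d u) (nxt d j ∷ w)                           ≡⟨ ∂-pre-nxt d u j<M gw ⟩
        - (sel d d (- c (nxt d j ∷ w)) + - t (ℓ d j ∷ w))   ≡⟨ cong₂ (λ y z → - (y + - z)) (sel-same d _) (tvan j w j<M gw) ⟩
        - (- c (nxt d j ∷ w) + - 0ℤ)                        ≡⟨ alg₂ _ ⟩
        c (nxt d j ∷ w) ∎
      ... | opp i i<M = trans (∂-pre-opp d u i<M gw) (sym (van i w i<M gw))

  module Reduce⁺ {k} (d : Bool) (c : X (suc (suc k))) (van : Van (not d) c) (cyc : ∂ c ≈ 𝟎) where
    open Reduce d c van

    -- x at ℓ d j is minus the value of ∂ c at nxt d j.
    x-van : Van d x
    x-van j v j<M@(s≤s j≤N) gv = begin
      c (ℓ d 0 ∷ ℓ d j ∷ v) + - (S d j (shift d c) v + ∂ (shift d c ▹ ℓ d j) v)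
        ≡⟨ cong₂ (λ y z → c (ℓ d 0 ∷ ℓ d j ∷ v) + - (y + z)) eq₁ eq₂ ⟩
      c (ℓ d 0 ∷ ℓ d j ∷ v) + - (- R + - ∂ (c ▹ nxt d j) v)
        ≡⟨ alg (c (ℓ d 0 ∷ ℓ d j ∷ v)) R _ ⟩
      S d (suc j) c v + ∂ (c ▹ nxt d j) v
        ≡⟨ cong (_+ ∂ (c ▹ nxt d j) v) (spl-nxt d j j<M gv van) ⟨
      spl (nxt d j) c v + ∂ (c ▹ nxt d j) v
        ≡⟨ neg≡0 (cyc (nxt d j ∷ v) (GoodL-nxt d j<M , gv)) ⟩
      0ℤ ∎
      where
      R : ℤ
      R = Σ< j λ i → c (ℓ d (suc i) ∷ ℓ d (j ∸ suc i) ∷ v)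
      alg : ∀ a b e → a + - (- b + - e) ≡ (a + b) + e
      alg = solve-∀
      eq₁ : S d j (shift d c) v ≡ - R
      eq₁ = trans
        (Σ<-cong j λ i i<j → trans (sel-same d _)
          (cong (λ s → - c (s ∷ ℓ d (j ∸ suc i) ∷ v)) (nxt-< d (ℕ.<-≤-trans i<j j≤N))))
        (Σ<-neg j _)
      eq₂ : ∂ (shift d c ▹ ℓ d j) v ≡ - ∂ (c ▹ nxt d j) v
      eq₂ = trans (∂-cong (λ z _ → sel-same d _) v gv) (∂-neg (c ▹ nxt d j) v)

    x-cyc : ∂ x ≈ 𝟎
    x-cyc w gw = trans (∂-⊕ (c ▹ ℓ d 0) (∂ (shift d c)) w) (cong₂ _+_
      (neg≡0 (trans (sym (neg-0+ (∂ (c ▹ ℓ d 0) w))) (cyc (ℓ d 0 ∷ w) (s≤s z≤n , gw))))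
      (∂∂ (shift d c) w))

    -- Carries the alternating coefficient through the reduction: the correction `∂ (shift d c)`
    -- vanishes here, because `shift d c` has no words on the opposite side and a unit step does not
    -- split.
    x-opp : ∀ v → Good v → x (ℓ (not d) 0 ∷ v) ≡ c (ℓ d 0 ∷ ℓ (not d) 0 ∷ v)
    x-opp v gv = trans
      (cong (c (ℓ d 0 ∷ ℓ (not d) 0 ∷ v) +_) (trans (neg-0+ _) (cong -_ (∂-zero (λ z _ → sel-not d _) v gv))))
      (+-identityʳ _)

  Good-alt : ∀ k d → Good (alt k d)
  Good-alt zero    d = tt
  Good-alt (suc k) d = s≤s z≤n , Good-alt k (not d)

  -- Induction on the degree: the remainder `x` of the reduction is a one-sided cycle for the other
  -- direction, one letter shorter, with the same alternating coefficient.
  bound-one-sided : ∀ k d (c : X (suc k)) → Van (not d) c → ∂ c ≈ 𝟎 → c (alt (suc k) d) ≡ 0ℤ →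
    Σ (X (suc (suc k))) λ u → Van (not d) u × ∂ u ≈ c
  bound-one-sided zero d c van cyc h =
    -- In degree zero all boundaries vanish, so `x` itself must be zero; its only value is the
    -- coefficient of `alt 1 d`.
    Reduce.finish d c van 𝟎 (λ _ _ _ _ → refl) λ { [] _ → sym (trans (+-identityʳ _) h) }
  bound-one-sided (suc k) d c van cyc h with
    bound-one-sided k (not d) x (subst (λ e → Van e x) (sym (not-involutive d)) x-van) x-cyc
      (trans (x-opp (alt k (not (not d))) (Good-alt k _)) h)
    where
    open Reduce d c van
    open Reduce⁺ d c van cyc
  ... | t , tvan , ∂t = Reduce.finish d c van t (subst (λ e → Van e t) (not-involutive d) tvan) ∂t

  -- Gluing the two sides and detecting homology by functionals

  Supp : ∀ {k} → ℕ → X k → Set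
  Supp l c = ∀ w → Good w → wt w ≢ l → c w ≡ 0ℤ

  Bd-zero : ∀ {k} {c : X k} → c ≈ 𝟎 → Bd c
  Bd-zero h = 𝟎 , λ w gw → trans (∂-𝟎 w) (sym (h w gw))

  -- The words beginning with `C` belong to both sides, so how the values of c there are shared out
  -- is left open as the parameter f.
  side : ∀ {k} → Bool → X (suc k) → X k → X (suc k)
  side d c f (ℓ e j ∷ w) = sel d e (c (ℓ e j ∷ w))
  side d c f (C     ∷ w) = f w

  side-van : ∀ {k} d (c : X (suc k)) f → Van (not d) (side d c f)
  side-van d c f j v _ _ = sel-not d _

  S-side : ∀ {k} d p (c : X (suc (suc k))) f w → S d p (side d c f) w ≡ S d p c w
  S-side d p c f w = Σ<-cong p λ j _ → sel-same d _

  ∂-side-same : ∀ {k} d (c : X (suc (suc k))) f i w → Good w →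
    ∂ (side d c f) (ℓ d i ∷ w) ≡ ∂ c (ℓ d i ∷ w)
  ∂-side-same d c f i w gw = cong -_ (cong₂ _+_
    (S-side d i c f w)
    (∂-cong (λ v _ → sel-same d _) w gw))

  ∂-side-opp : ∀ {k} d (c : X (suc (suc k))) f i w → Good w →
    ∂ (side d c f) (ℓ (not d) i ∷ w) ≡ 0ℤ
  ∂-side-opp d c f i w gw = cong -_ (cong₂ _+_
    (Σ<-zero i λ j _ → sel-not d _)
    (∂-zero (λ v _ → sel-not d _) w gw))

  ∂-side-C : ∀ {k} d (c : X (suc (suc k))) f w → Good w →
    ∂ (side d c f) (C ∷ w) ≡ - (S d M c w + ∂ f w)
  ∂-side-C d c f w gw = cong (λ z → - (z + ∂ f w)) (begin
    spl C (side d c f) w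
      ≡⟨ spl-C d (side d c f) w ⟩
    S d M (side d c f) w + S (not d) M (side d c f) w
      ≡⟨ cong₂ _+_ (S-side d M c f w) (S-van (not d) M (side d c f) ℕ.≤-refl gw (side-van d c f)) ⟩
    S d M c w + 0ℤ
      ≡⟨ +-identityʳ _ ⟩
    S d M c w ∎)

  ∂-side-cyc : ∀ {k} d (c : X (suc (suc k))) f → ∂ c ≈ 𝟎 → (∀ w → Good w → S d M c w + ∂ f w ≡ 0ℤ) →
    ∂ (side d c f) ≈ 𝟎
  ∂-side-cyc d c f cyc h (C ∷ w) (_ , gw) = trans (∂-side-C d c f w gw) (cong -_ (h w gw))
  ∂-side-cyc d c f cyc h (ℓ e i ∷ w) (gi , gw) with same-or-not d e
  ... | inj₁ refl = trans (∂-side-same d c f i w gw) (cyc (ℓ d i ∷ w) (gi , gw))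
  ... | inj₂ refl = ∂-side-opp d c f i w gw

  -- The two sides add up to c for every f, and alternating words never begin with `C`, so f does
  -- not affect their coefficients. It remains to choose f so that both sides are cycles.
  bound-sides : ∀ {k} (c : X (suc k)) (f : X k) →
    ∂ (side false c (c ▹ C ⊕ f)) ≈ 𝟎 → ∂ (side true c (⊖ f)) ≈ 𝟎 →
    (∀ d → c (alt (suc k) d) ≡ 0ℤ) → Bd c
  bound-sides {k} c f cyc₀ cyc₁ h
    with bound-one-sided k false (side false c (c ▹ C ⊕ f)) (side-van false c (c ▹ C ⊕ f)) cyc₀ (h false)
       | bound-one-sided k true (side true c (⊖ f)) (side-van true c (⊖ f)) cyc₁ (h true)
  ... | u₀ , _ , ∂u₀ | u₁ , _ , ∂u₁ =
    u₀ ⊕ u₁ , λ w gw → trans (∂-⊕ u₀ u₁ w) (trans (cong₂ _+_ (∂u₀ w gw) (∂u₁ w gw)) (sides w))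
    where
    alg : ∀ a b → (a + b) + - b ≡ a
    alg = solve-∀
    sides : ∀ w → side false c (c ▹ C ⊕ f) w + side true c (⊖ f) w ≡ c w
    sides (ℓ false i ∷ w) = +-identityʳ _
    sides (ℓ true  i ∷ w) = +-identityˡ _
    sides (C ∷ w)         = alg (c (C ∷ w)) (f w)

  -- The connecting map for gluing the two one-sided subcomplexes along the words starting with C.
  E : ∀ {k} → X (suc (suc k)) → X k
  E = S true M

  bound₁ : (c : X 1) → (∀ d → c (alt 1 d) ≡ 0ℤ) → Bd c
  bound₁ c h = bound-sides c 𝟎 (λ { [] _ → refl }) (λ { [] _ → refl }) h

  -- At words beginning with `C`, the `true` side is a cycle precisely when `∂ f` is `E c`; the
  -- `false` side then closes up because c is a cycle. So the obstruction to splitting c is the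
  -- class of `E c`.
  bound₂ : ∀ {k} (c : X (suc (suc k))) → ∂ c ≈ 𝟎 → Bd (E c) → (∀ d → c (alt (suc (suc k)) d) ≡ 0ℤ) → Bd c
  bound₂ {k} c cyc (f , ∂f) h = bound-sides c f
    (∂-side-cyc false c (c ▹ C ⊕ f) cyc λ w gw → begin
      S false M c w + ∂ (c ▹ C ⊕ f) w             ≡⟨ cong (S false M c w +_) (∂-⊕ (c ▹ C) f w) ⟩
      S false M c w + (∂ (c ▹ C) w + ∂ f w)       ≡⟨ cong (λ z → S false M c w + (∂ (c ▹ C) w + z)) (∂f w gw) ⟩
      S false M c w + (∂ (c ▹ C) w + S true M c w) ≡⟨ alg (S false M c w) (∂ (c ▹ C) w) (S true M c w) ⟩
      S false M c w + S true M c w + ∂ (c ▹ C) w  ≡⟨ neg≡0 (cyc (C ∷ w) (tt , gw)) ⟩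
      0ℤ ∎)
    (∂-side-cyc true c (⊖ f) cyc λ w gw → begin
      S true M c w + ∂ (⊖ f) w ≡⟨ cong (S true M c w +_) (trans (∂-neg f w) (cong -_ (∂f w gw))) ⟩
      S true M c w + - S true M c w ≡⟨ +-inverseʳ (S true M c w) ⟩
      0ℤ ∎)
    h
    where
    alg : ∀ a b e → a + (b + e) ≡ (a + e) + b
    alg = solve-∀

  -- Indexes a basis of the degree k, weight l homology of the complex of words.
  Idx : ℕ → ℕ → Set
  Idx zero          l = l ≡ 0
  Idx (suc zero)    l = l ≡ 1 × Bool
  Idx (suc (suc k)) l = (l ≡ suc (suc k) × Bool) ⊎ Σ ℕ λ l′ → l ≡ suc M ℕ.+ l′ × Idx k l′

  -- The functionals dual to `ζ`: an alternating coefficient, or a functional two degrees lower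
  -- pulled back along `E`. They descend to homology because `E` commutes with `∂` and by `∂-alt`.
  γ : ∀ k {l} → Idx k l → X k → ℤ
  γ zero          _                   c = c []
  γ (suc zero)    (_ , d)             c = c (alt 1 d)
  γ (suc (suc k)) (inj₁ (_ , d))      c = c (alt (suc (suc k)) d)
  γ (suc (suc k)) (inj₂ (_ , _ , i))  c = γ k i (E c)

  wt-alt : ∀ k d → wt (alt k d) ≡ k
  wt-alt zero    d = refl
  wt-alt (suc k) d = cong suc (wt-alt k (not d))

  γ-agree : ∀ k {l} (i : Idx k l) {c c′} → Agree l c c′ → γ k i c ≡ γ k i c′
  γ-agree zero          refl                 h = h [] tt refl
  γ-agree (suc zero)    (refl , d)           h = h (alt 1 d) (Good-alt 1 d) refl
  γ-agree (suc (suc k)) (inj₁ (refl , d))    h = h (alt (suc (suc k)) d) (Good-alt (suc (suc k)) d) (wt-alt (suc (suc k)) d)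
  γ-agree (suc (suc k)) (inj₂ (_ , refl , i)) {c} {c′} h = γ-agree k i λ { v gv refl →
    S-cong true M {c} {c′} ℕ.≤-refl gv h }

  γ-cong : ∀ k {l} (i : Idx k l) {c c′} → c ≈ c′ → γ k i c ≡ γ k i c′
  γ-cong k i h = γ-agree k i λ v gv _ → h v gv

  γ-⊕ : ∀ k {l} (i : Idx k l) c c′ → γ k i (c ⊕ c′) ≡ γ k i c + γ k i c′
  γ-⊕ zero          i        c c′ = refl
  γ-⊕ (suc zero)    i        c c′ = refl
  γ-⊕ (suc (suc k)) (inj₁ _) c c′ = refl
  γ-⊕ (suc (suc k)) (inj₂ (_ , _ , i)) c c′ =
    trans (γ-cong k i λ v _ → S-⊕ true M c c′ v) (γ-⊕ k i (E c) (E c′))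

  γ-⊙ : ∀ k {l} (i : Idx k l) a c → γ k i (a ⊙ c) ≡ a * γ k i c
  γ-⊙ zero          i        a c = refl
  γ-⊙ (suc zero)    i        a c = refl
  γ-⊙ (suc (suc k)) (inj₁ _) a c = refl
  γ-⊙ (suc (suc k)) (inj₂ (_ , _ , i)) a c =
    trans (γ-cong k i λ v _ → S-⊙ true M a c v) (γ-⊙ k i a (E c))

  -- Unit steps do not split, so no word has an alternating word as a face.
  ∂-alt : ∀ k d (u : X (suc k)) → ∂ u (alt k d) ≡ 0ℤ
  ∂-alt zero    d u = refl
  ∂-alt (suc k) d u = trans (neg-0+ _) (cong -_ (∂-alt k (not d) (u ▹ ℓ d 0)))

  γ-∂ : ∀ k {l} (i : Idx k l) u → γ k i (∂ u) ≡ 0ℤ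
  γ-∂ zero          i              u = refl
  γ-∂ (suc zero)    (_ , d)        u = ∂-alt 1 d u
  γ-∂ (suc (suc k)) (inj₁ (_ , d)) u = ∂-alt (suc (suc k)) d u
  γ-∂ (suc (suc k)) (inj₂ (_ , _ , i)) u =
    trans (γ-cong k i λ v _ → S-∂ true M u v) (γ-∂ k i (E u))

  E-supp : ∀ {k l} (c : X (suc (suc k))) → Supp l c → ∀ w → Good w → suc M ℕ.+ wt w ≢ l → E c w ≡ 0ℤ
  E-supp c h w gw ne = trans
    (S-cong true M {c} {𝟎} ℕ.≤-refl gw λ v gv e → h v gv λ e′ → ne (trans (sym e) e′))
    (Σ<-zero M λ _ _ → refl)

  E-cyc : ∀ {k} (c : X (suc (suc k))) → ∂ c ≈ 𝟎 → Cyc (E c)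
  E-cyc {zero}  c cyc = tt
  E-cyc {suc k} c cyc w gw = begin
    ∂ (E c) w ≡⟨ S-∂ true M c w ⟨
    E (∂ c) w ≡⟨ S-cong true M {∂ c} {𝟎} ℕ.≤-refl gw (λ v gv _ → cyc v gv) ⟩
    E 𝟎 w     ≡⟨ (Σ<-zero M λ _ _ → refl) ⟩
    0ℤ        ∎

  -- The `inj₁` functionals supply the vanishing alternating coefficients. The `inj₂` functionals
  -- are those of `E c`, a cycle of weight l - m and two degrees lower, to which the induction
  -- applies; if l < m, then `E c` is zero for reasons of weight.
  bound : ∀ k {l} (c : X k) → Cyc c → Supp l c → (∀ (i : Idx k l) → γ k i c ≡ 0ℤ) → Bd c
  bound zero {l} c cyc supp h = Bd-zero λ { [] _ → c0 }
    where
    c0 : c [] ≡ 0ℤ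
    c0 with l ℕ.≟ 0
    ... | yes e = h e
    ... | no ne = supp [] tt (ne ∘ sym)
  bound (suc zero) {l} c cyc supp h = bound₁ c λ d → calt d
    where
    calt : ∀ d → c (alt 1 d) ≡ 0ℤ
    calt d with l ℕ.≟ 1
    ... | yes e = h (e , d)
    ... | no ne = supp (alt 1 d) (Good-alt 1 d) (ne ∘ sym)
  bound (suc (suc k)) {l} c cyc supp h = bound₂ c cyc BdE calt
    where
    calt : ∀ d → c (alt (suc (suc k)) d) ≡ 0ℤ
    calt d with l ℕ.≟ suc (suc k)
    ... | yes e = h (inj₁ (e , d))
    ... | no ne = supp (alt _ d) (Good-alt (suc (suc k)) d) λ e → ne (trans (sym e) (wt-alt (suc (suc k)) d))
    BdE : Bd (E c)
    BdE with suc M ℕ.≤? l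
    ... | no M≰l = Bd-zero λ w gw → E-supp c supp w gw λ { refl → M≰l (ℕ.m≤m+n (suc M) (wt w)) }
    ... | yes M≤l = bound k (E c) (E-cyc c cyc)
      (λ w gw ne → E-supp c supp w gw λ { refl → ne (sym (ℕ.m+n∸m≡n (suc M) (wt w))) })
      (λ i → h (inj₂ (l ∸ suc M , sym (ℕ.m+[n∸m]≡n M≤l) , i)))

  -- Cycles dual to the functionals

  δalt : ∀ k → Bool → X k
  δalt zero    d _ = 1ℤ
  δalt (suc k) d   = pre d (δalt k (not d))

  -- Consecutive letters are unit steps in opposite directions, and these never merge.
  δalt-cyc : ∀ k d → Cyc (δalt k d)
  δalt-cyc zero          d = tt
  δalt-cyc (suc zero)    d [] _ = refl
  δalt-cyc (suc (suc k)) d (s ∷ w) (gs , gw) with view d s gs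
  ... | first      = trans (∂-pre-first d _ gw) (cong -_ (δalt-cyc (suc k) (not d) w gw))
  ... | opp i i<M  = ∂-pre-opp d (δalt (suc k) (not d)) i<M gw
  ... | next j j<M = trans (∂-pre-nxt d (δalt (suc k) (not d)) j<M gw) (cong -_
        (subst (λ e → Van e (δalt (suc k) (not d))) (not-involutive d) (pre-van (not d) (δalt k (not (not d)))) j w j<M gw))

  δalt-same : ∀ k d → δalt k d (alt k d) ≡ 1ℤ
  δalt-same zero    d = refl
  δalt-same (suc k) d = trans (sel-same d _) (δalt-same k (not d))

  δalt-not : ∀ k {d e} → d ≢ e → δalt (suc k) d (alt (suc k) e) ≡ 0ℤ
  δalt-not k {d} {e} ne with same-or-not d e
  ... | inj₁ refl = ⊥-elim (ne refl)
  ... | inj₂ refl = sel-not d _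

  preC : ∀ {k} → X k → X (suc k)
  preC z (ℓ _ _ ∷ w) = 0ℤ
  preC z (C     ∷ w) = z w

  -- No splitting has `C` as a piece, that is, an antipodal step merges with nothing; only the
  -- differential of z behind it is left.
  preC-cyc : ∀ {k} (z : X k) → Cyc z → ∂ (preC z) ≈ 𝟎
  preC-cyc {zero}  z cyc []          _        = refl
  preC-cyc {suc k} z cyc (ℓ d i ∷ w) (_ , gw) = cong -_ (cong₂ _+_ (Σ<-zero i λ _ _ → refl) (∂-𝟎 w))
  preC-cyc {suc k} z cyc (C ∷ w)     (_ , gw) = cong -_ (cong₂ _+_
    (cong₂ _+_ (Σ<-zero M λ _ _ → refl) (Σ<-zero M λ _ _ → refl)) (cyc w gw))

  -- A section of E up to boundaries: bound C·z on either side and glue.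
  lift : ∀ {k} (z : X k) → Cyc z →
    Σ (X (suc (suc k))) λ c → ∂ c ≈ 𝟎 × Σ (X (suc k)) λ f → E c ≈ z ⊕ ∂ f
  lift {k} z cyc
    with bound-one-sided k false (preC z) (λ _ _ _ _ → refl) (preC-cyc z cyc) refl
       | bound-one-sided k true (preC z) (λ _ _ _ _ → refl) (preC-cyc z cyc) refl
  ... | u₀ , van₀ , ∂u₀ | u₁ , van₁ , ∂u₁ = u₀ ⊕ ⊖ u₁ , cyc′ , u₁ ▹ C , Ec
    where
    cyc′ : ∂ (u₀ ⊕ ⊖ u₁) ≈ 𝟎
    cyc′ w gw = trans (∂-⊕ u₀ (⊖ u₁) w) (trans
      (cong₂ _+_ (∂u₀ w gw) (trans (∂-neg u₁ w) (cong -_ (∂u₁ w gw))))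
      (+-inverseʳ (preC z w)))
    alg : ∀ e f → 0ℤ + - e ≡ - (0ℤ + e + f) + f
    alg = solve-∀
    Ec : E (u₀ ⊕ ⊖ u₁) ≈ z ⊕ ∂ (u₁ ▹ C)
    Ec w gw = begin
      E (u₀ ⊕ ⊖ u₁) w
        ≡⟨ trans (S-⊕ true M u₀ (⊖ u₁) w) (cong (E u₀ w +_) (S-neg true M u₁ w)) ⟩
      E u₀ w + - E u₁ w
        ≡⟨ cong (_+ - E u₁ w) (S-van true M u₀ ℕ.≤-refl gw van₀) ⟩
      0ℤ + - E u₁ w
        ≡⟨ alg (E u₁ w) (∂ (u₁ ▹ C) w) ⟩
      - (0ℤ + E u₁ w + ∂ (u₁ ▹ C) w) + ∂ (u₁ ▹ C) w
        ≡⟨ cong (λ y → - (y + E u₁ w + ∂ (u₁ ▹ C) w) + ∂ (u₁ ▹ C) w) (S-van false M u₁ ℕ.≤-refl gw van₁) ⟨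
      ∂ u₁ (C ∷ w) + ∂ (u₁ ▹ C) w
        ≡⟨ cong (_+ ∂ (u₁ ▹ C) w) (∂u₁ (C ∷ w) (tt , gw)) ⟩
      z w + ∂ (u₁ ▹ C) w ∎

  ζ : ∀ k {l} → Idx k l → Σ (X k) Cyc
  ζ zero          i              = δalt 0 false , tt
  ζ (suc zero)    (_ , d)        = δalt 1 d , δalt-cyc 1 d
  ζ (suc (suc k)) (inj₁ (_ , d)) = δalt (suc (suc k)) d , δalt-cyc (suc (suc k)) d
  ζ (suc (suc k)) (inj₂ (_ , _ , i)) = proj₁ c , proj₁ (proj₂ c)
    where c = lift (proj₁ (ζ k i)) (proj₂ (ζ k i))

  -- `E` of the lift differs from the original cycle by some `∂ f`, which `γ k i` does not see.
  γ-lift : ∀ k {l l₁} (e : l₁ ≡ suc M ℕ.+ l) {l₂} (e′ : l₂ ≡ suc M ℕ.+ l) (i j : Idx k l) →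
    γ (suc (suc k)) {l₁} (inj₂ (l , e , i)) (proj₁ (ζ (suc (suc k)) {l₂} (inj₂ (l , e′ , j)))) ≡ γ k i (proj₁ (ζ k j))
  γ-lift k e e′ i j = begin
    γ k i (E (proj₁ L))                      ≡⟨ γ-cong k i (proj₂ (proj₂ (proj₂ L))) ⟩
    γ k i (proj₁ (ζ k j) ⊕ ∂ f)              ≡⟨ γ-⊕ k i _ _ ⟩
    γ k i (proj₁ (ζ k j)) + γ k i (∂ f)      ≡⟨ cong (γ k i (proj₁ (ζ k j)) +_) (γ-∂ k i f) ⟩
    γ k i (proj₁ (ζ k j)) + 0ℤ               ≡⟨ +-identityʳ _ ⟩
    γ k i (proj₁ (ζ k j)) ∎
    where
    L = lift (proj₁ (ζ k j)) (proj₂ (ζ k j))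
    f = proj₁ (proj₂ (proj₂ L))

  γ-ζ-same : ∀ k {l} (i : Idx k l) → γ k i (proj₁ (ζ k i)) ≡ 1ℤ
  γ-ζ-same zero          i                  = refl
  γ-ζ-same (suc zero)    (_ , d)            = δalt-same 1 d
  γ-ζ-same (suc (suc k)) (inj₁ (_ , d))     = δalt-same (suc (suc k)) d
  γ-ζ-same (suc (suc k)) (inj₂ (_ , e , i)) = trans (γ-lift k e e i i) (γ-ζ-same k i)

  Idx-≤ : ∀ k {l} → Idx k l → k ≤ l
  Idx-≤ zero          _                   = z≤n
  Idx-≤ (suc zero)    (refl , _)          = ℕ.≤-refl
  Idx-≤ (suc (suc k)) (inj₁ (refl , _))   = ℕ.≤-refl
  Idx-≤ (suc (suc k)) (inj₂ (l , refl , i)) = s≤s (s≤s (ℕ.≤-trans (Idx-≤ k i) (ℕ.m≤n+m l N)))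

  -- Indices satisfy k ≤ l′, so a lifted class has weight at least m + k. This exceeds k + 2, since
  -- `1 ≤ N` says m ≥ 3.
  alt≢lift : 1 ≤ N → ∀ k {l′} → Idx k l′ → ¬ suc (suc k) ≡ suc M ℕ.+ l′
  alt≢lift 1≤N k {l′} i e = ℕ.<⇒≢ (ℕ.≤-<-trans (Idx-≤ k i) (ℕ.m<n+m l′ 1≤N)) (ℕ.suc-injective (ℕ.suc-injective e))

  γ-ζ-diff : 1 ≤ N → ∀ k {l} (i j : Idx k l) → i ≢ j → γ k i (proj₁ (ζ k j)) ≡ 0ℤ
  γ-ζ-diff 1≤N zero i j ne = ⊥-elim (ne (ℕ.≡-irrelevant i j))
  γ-ζ-diff 1≤N (suc zero) (refl , d) (refl , e) ne = δalt-not 0 {e} {d} λ { refl → ne refl }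
  γ-ζ-diff 1≤N (suc (suc k)) (inj₁ (refl , d)) (inj₁ (refl , e)) ne = δalt-not (suc k) {e} {d} λ { refl → ne refl }
  γ-ζ-diff 1≤N (suc (suc k)) (inj₁ (refl , _)) (inj₂ (_ , e , i)) ne = ⊥-elim (alt≢lift 1≤N k i e)
  γ-ζ-diff 1≤N (suc (suc k)) (inj₂ (_ , e , i)) (inj₁ (refl , _)) ne = ⊥-elim (alt≢lift 1≤N k i e)
  γ-ζ-diff 1≤N (suc (suc k)) (inj₂ (l , refl , i)) (inj₂ (l′ , e , j)) ne with ℕ.+-cancelˡ-≡ (suc M) l l′ e
  ... | refl with ℕ.≡-irrelevant e refl
  ... | refl = trans (γ-lift k refl refl i j) (γ-ζ-diff 1≤N k i j λ { refl → ne refl })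

-- The local function `search` of `MC.dist` has no name outside its definition; abstracting the
-- parameters of one unfolding lets unification find it.
mutual
  search : (n : ℕ) (adj : Fin n → Fin n → Bool) (x y : Fin n) → ℕ → ℕ → ℕ
  search = _

  dist-unfold : ∀ n (adj : Fin (suc n) → Fin (suc n) → Bool) x y →
    MC.dist (suc n) adj x y ≡ (if ⌊ x ≟ y ⌋ then 0 else search (suc n) adj x y n 1)
  dist-unfold n adj x y with suc n | 1
  ... | n′ | t = refl

-- The range t ≤ d < t + f says that the search has not yet passed d and has enough fuel left to
-- arrive there.
search-least : ∀ n adj x y f t d → t ≤ d → d < t ℕ.+ f → IsTrue (MC.within n adj d x y) →
  (∀ s → s < d → ¬ IsTrue (MC.within n adj s x y)) → search n adj x y f t ≡ d
search-least n adj x y zero t d t≤d d<t w h = ⊥-elim (ℕ.<⇒≱ (subst (d <_) (ℕ.+-identityʳ t) d<t) t≤d)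
search-least n adj x y (suc f) t d t≤d d<t w h with MC.within n adj t x y in eq
... | true  = Sum.[ (λ t<d → ⊥-elim (h t t<d (Equivalence.from T-≡ eq))) , (λ e → e) ]′ (ℕ.m≤n⇒m<n∨m≡n t≤d)
... | false = search-least n adj x y f (suc t) d
  (ℕ.≤∧≢⇒< t≤d λ { refl → subst IsTrue eq w }) (subst (d <_) (ℕ.+-suc t f) d<t) w h

dist-least : ∀ n adj x y d → d < n → IsTrue (MC.within n adj d x y) →
  (∀ s → s < d → ¬ IsTrue (MC.within n adj s x y)) → MC.dist n adj x y ≡ d
dist-least n adj x y d d<n = search-least n adj x y n 0 d z≤n d<n

-- Rotations and distances in a cycle

module Rotation (n : ℕ) .{{_ : NonZero n}} where

  open import Data.Nat using (_+_)
  open Equivalence using (to; from)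

  rot : Fin n → ℕ → Fin n
  rot x i = (toℕ x + i) mod n

  toℕ-rot : ∀ x i → toℕ (rot x i) ≡ (toℕ x + i) % n
  toℕ-rot x i = toℕ-fromℕ< (m%n<n (toℕ x + i) n)

  %-+ˡ : ∀ a b → (a % n + b) % n ≡ (a + b) % n
  %-+ˡ a b = begin
    (a % n + b) % n             ≡⟨ %-distribˡ-+ (a % n) b n ⟩
    (a % n % n + b % n) % n     ≡⟨ cong (λ z → (z + b % n) % n) (m%n%n≡m%n a n) ⟩
    (a % n + b % n) % n         ≡⟨ %-distribˡ-+ a b n ⟨
    (a + b) % n ∎

  rot-rot : ∀ x i j → rot (rot x i) j ≡ rot x (i + j)
  rot-rot x i j = toℕ-injective (begin
    toℕ (rot (rot x i) j)     ≡⟨ toℕ-rot (rot x i) j ⟩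
    (toℕ (rot x i) + j) % n   ≡⟨ cong (λ z → (z + j) % n) (toℕ-rot x i) ⟩
    ((toℕ x + i) % n + j) % n ≡⟨ %-+ˡ (toℕ x + i) j ⟩
    (toℕ x + i + j) % n       ≡⟨ cong (_% n) (ℕ.+-assoc (toℕ x) i j) ⟩
    (toℕ x + (i + j)) % n     ≡⟨ toℕ-rot x (i + j) ⟨
    toℕ (rot x (i + j)) ∎)

  rot-0 : ∀ x → rot x 0 ≡ x
  rot-0 x = toℕ-injective (trans (toℕ-rot x 0)
    (trans (cong (_% n) (ℕ.+-identityʳ (toℕ x))) (m<n⇒m%n≡m (toℕ<n x))))

  rot-n : ∀ x → rot x n ≡ x
  rot-n x = toℕ-injective (trans (toℕ-rot x n) (trans ([m+n]%n≡m%n (toℕ x) n) (m<n⇒m%n≡m (toℕ<n x))))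

  -- The difference of y and x modulo n, with n added in to keep truncated subtraction exact.
  off : Fin n → Fin n → ℕ
  off x y = (toℕ y + (n ∸ toℕ x)) % n

  off<n : ∀ x y → off x y < n
  off<n x y = m%n<n (toℕ y + (n ∸ toℕ x)) n

  off-rot : ∀ x {i} → i < n → off x (rot x i) ≡ i
  off-rot x {i} i<n = begin
    (toℕ (rot x i) + (n ∸ toℕ x)) % n   ≡⟨ cong (λ z → (z + (n ∸ toℕ x)) % n) (toℕ-rot x i) ⟩
    ((toℕ x + i) % n + (n ∸ toℕ x)) % n ≡⟨ %-+ˡ (toℕ x + i) (n ∸ toℕ x) ⟩
    (toℕ x + i + (n ∸ toℕ x)) % n       ≡⟨ cong (λ z → (z + (n ∸ toℕ x)) % n) (ℕ.+-comm (toℕ x) i) ⟩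
    (i + toℕ x + (n ∸ toℕ x)) % n       ≡⟨ cong (_% n) (trans (ℕ.+-assoc i (toℕ x) _) (cong (i +_) (ℕ.m+[n∸m]≡n (ℕ.<⇒≤ (toℕ<n x))))) ⟩
    (i + n) % n                         ≡⟨ [m+n]%n≡m%n i n ⟩
    i % n                               ≡⟨ m<n⇒m%n≡m i<n ⟩
    i ∎

  rot-off : ∀ x y → rot x (off x y) ≡ y
  rot-off x y = toℕ-injective (begin
    toℕ (rot x (off x y))                     ≡⟨ toℕ-rot x (off x y) ⟩
    (toℕ x + off x y) % n                     ≡⟨ cong (_% n) (ℕ.+-comm (toℕ x) (off x y)) ⟩
    (off x y + toℕ x) % n                     ≡⟨ %-+ˡ (toℕ y + (n ∸ toℕ x)) (toℕ x) ⟩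
    (toℕ y + (n ∸ toℕ x) + toℕ x) % n         ≡⟨ cong (_% n) (trans (ℕ.+-assoc (toℕ y) _ (toℕ x)) (cong (toℕ y +_) (ℕ.m∸n+n≡m (ℕ.<⇒≤ (toℕ<n x))))) ⟩
    (toℕ y + n) % n                           ≡⟨ [m+n]%n≡m%n (toℕ y) n ⟩
    toℕ y % n                                 ≡⟨ m<n⇒m%n≡m (toℕ<n y) ⟩
    toℕ y ∎)

  rot-injective : ∀ x {i j} → i < n → j < n → rot x i ≡ rot x j → i ≡ j
  rot-injective x i<n j<n e = trans (sym (off-rot x i<n)) (trans (cong (off x) e) (off-rot x j<n))

  -- Has the same body as the local successor test in `cycleAdj`, so adjacency unfolds to it.
  succᵇ : Fin n → Fin n → Bool
  succᵇ a b = (toℕ b ≡ᵇ suc (toℕ a)) ∨ ((suc (toℕ a) ≡ᵇ n) ∧ (toℕ b ≡ᵇ 0))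

  succ⇒rot : ∀ {a b} → IsTrue (succᵇ a b) → b ≡ rot a 1
  succ⇒rot {a} {b} h = toℕ-injective (trans lem (sym (trans (toℕ-rot a 1) (cong (_% n) (ℕ.+-comm (toℕ a) 1)))))
    where
    lem : toℕ b ≡ suc (toℕ a) % n
    lem with to (T-∨ {toℕ b ≡ᵇ suc (toℕ a)}) h
    ... | inj₁ e = trans b≡ (sym (m<n⇒m%n≡m (subst (_< n) b≡ (toℕ<n b))))
      where b≡ = ℕ.≡ᵇ⇒≡ (toℕ b) (suc (toℕ a)) e
    ... | inj₂ e with to (T-∧ {suc (toℕ a) ≡ᵇ n}) e
    ...   | p , q = trans (ℕ.≡ᵇ⇒≡ (toℕ b) 0 q) (sym (trans (cong (_% n) (ℕ.≡ᵇ⇒≡ (suc (toℕ a)) n p)) (n%n≡0 n)))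

  succ-rot : ∀ a → IsTrue (succᵇ a (rot a 1))
  succ-rot a with ℕ.m≤n⇒m<n∨m≡n (toℕ<n a)
  ... | inj₁ lt = from T-∨ (inj₁ (ℕ.≡⇒≡ᵇ _ _ (trans (trans (toℕ-rot a 1) (cong (_% n) (ℕ.+-comm (toℕ a) 1))) (m<n⇒m%n≡m lt))))
  ... | inj₂ eq = from (T-∨ {toℕ (rot a 1) ≡ᵇ suc (toℕ a)}) (inj₂ (from T-∧ (ℕ.≡⇒≡ᵇ _ _ eq , ℕ.≡⇒≡ᵇ _ _
      (trans (trans (toℕ-rot a 1) (cong (_% n) (trans (ℕ.+-comm (toℕ a) 1) eq))) (n%n≡0 n)))))

  adj⇒rot : ∀ {a b} → IsTrue (cycleAdj n a b) → b ≡ rot a 1 ⊎ a ≡ rot b 1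
  adj⇒rot {a} {b} h = Sum.map succ⇒rot succ⇒rot (to (T-∨ {succᵇ a b}) h)

  adj-rot : ∀ a → IsTrue (cycleAdj n a (rot a 1))
  adj-rot a = from T-∨ (inj₁ (succ-rot a))

  adj-rot′ : ∀ a → IsTrue (cycleAdj n (rot a 1) a)
  adj-rot′ a = from (T-∨ {succᵇ (rot a 1) a}) (inj₂ (succ-rot a))

  open MC n (cycleAdj n) using (within; dist)

  within-keep : ∀ t {x y} → IsTrue (within t x y) → IsTrue (within (suc t) x y)
  within-keep t h = from T-∨ (inj₁ h)

  within-step : ∀ t {x z y} → IsTrue (within t x z) → IsTrue (cycleAdj n z y) → IsTrue (within (suc t) x y)
  within-step t {x} {z} {y} h a =
    from (T-∨ {within t x y}) (inj₂ (any⁺ _ (lose (∈-allFin z) (from T-∧ (h , a)))))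

  within-split : ∀ t {x y} → IsTrue (within (suc t) x y) →
    IsTrue (within t x y) ⊎ ∃ λ z → IsTrue (within t x z) × IsTrue (cycleAdj n z y)
  within-split t {x} {y} h = Sum.map₂
    (λ a → let z , p = Any.satisfied (any⁻ (λ z → within t x z ∧ cycleAdj n z y) (allFin n) a) in z , to T-∧ p)
    (to (T-∨ {within t x y}) h)

  within-forward : ∀ t x i → i ≤ t → IsTrue (within t x (rot x i))
  within-forward zero    x zero    _ = fromWitness (sym (rot-0 x))
  within-forward (suc t) x zero    _ = within-keep t (within-forward t x zero z≤n)
  within-forward (suc t) x (suc i) (s≤s i≤t) = within-step t (within-forward t x i i≤t)
    (subst (λ z → IsTrue (cycleAdj n (rot x i) z)) (trans (rot-rot x i 1) (cong (rot x) (ℕ.+-comm i 1))) (adj-rot (rot x i)))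

  -- The walk runs backwards from `rot x n`, which is x: the vertex at offset i is reached from the
  -- one at offset i + 1.
  within-backward : ∀ t x i → i ≤ n → n ≤ i + t → IsTrue (within t x (rot x i))
  within-backward zero x i i≤n n≤i =
    fromWitness (sym (trans (cong (rot x) (ℕ.≤-antisym i≤n (subst (n ≤_) (ℕ.+-identityʳ i) n≤i))) (rot-n x)))
  within-backward (suc t) x i i≤n h with ℕ.m≤n⇒m<n∨m≡n i≤n
  ... | inj₂ refl = within-keep t (within-backward t x i i≤n (ℕ.m≤m+n i t))
  ... | inj₁ i<n = within-step t (within-backward t x (suc i) i<n (subst (n ≤_) (ℕ.+-suc i t) h))
    (subst (λ z → IsTrue (cycleAdj n z (rot x i))) (trans (rot-rot x i 1) (cong (rot x) (ℕ.+-comm i 1))) (adj-rot′ (rot x i)))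

  -- Invariant of walks from x: after t steps the offset is within t of 0 or within t of n. A step
  -- changes the offset by one, except across x, where offsets 0 and n are the same vertex.
  within-sound : ∀ t x i → i < n → IsTrue (within t x (rot x i)) → i ≤ t ⊎ n ≤ i + t
  within-sound zero x i i<n h = inj₁ (ℕ.≤-reflexive (sym
    (rot-injective x (ℕ.≤-<-trans z≤n i<n) i<n (trans (rot-0 x) (toWitness h)))))
  within-sound (suc t) x i i<n h with within-split t h
  ... | inj₁ w = Sum.map ℕ.m≤n⇒m≤1+n (λ p → ℕ.≤-trans p (ℕ.+-monoʳ-≤ i (ℕ.n≤1+n t))) (within-sound t x i i<n w)
  ... | inj₂ (z , w , a) with off x z | off<n x z | rot-off x z
  ...   | j | j<n | refl with within-sound t x j j<n w | adj⇒rot a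
  ...     | near | inj₁ e = forward near (ℕ.m≤n⇒m<n∨m≡n j<n)
    where
    e′ : rot x i ≡ rot x (suc j)
    e′ = trans e (trans (rot-rot x j 1) (cong (rot x) (ℕ.+-comm j 1)))
    forward : j ≤ t ⊎ n ≤ j + t → suc j < n ⊎ suc j ≡ n → i ≤ suc t ⊎ n ≤ i + suc t
    -- The walk returns to x here: offset j + 1 = n is offset 0, so i = 0.
    forward near (inj₂ refl) = inj₁ (ℕ.≤-trans (ℕ.≤-reflexive
      (rot-injective x i<n (s≤s z≤n) (trans e′ (trans (rot-n x) (sym (rot-0 x)))))) z≤n)
    forward near (inj₁ lt) with rot-injective x i<n lt e′
    ... | refl = Sum.map s≤s (λ p → ℕ.≤-trans p (ℕ.≤-trans (ℕ.n≤1+n (j + t)) (ℕ.+-monoʳ-≤ (suc j) (ℕ.n≤1+n t)))) near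
  ...     | near | inj₂ e = backward near (ℕ.m≤n⇒m<n∨m≡n i<n)
    where
    e′ : rot x j ≡ rot x (suc i)
    e′ = trans e (trans (rot-rot x i 1) (cong (rot x) (ℕ.+-comm i 1)))
    backward : j ≤ t ⊎ n ≤ j + t → suc i < n ⊎ suc i ≡ n → i ≤ suc t ⊎ n ≤ i + suc t
    backward near (inj₂ refl) = inj₂ (subst (suc i ≤_) (sym (ℕ.+-suc i t)) (s≤s (ℕ.m≤m+n i t)))
    backward near (inj₁ lt) with rot-injective x j<n lt e′
    ... | refl = Sum.map (λ p → ℕ.≤-trans (ℕ.n≤1+n i) (ℕ.m≤n⇒m≤1+n p)) (subst (n ≤_) (sym (ℕ.+-suc i t))) near

  -- The endpoint i = n is included so that backward walks, which are rotations by `n ∸ i`, are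
  -- covered down to length 0.
  dist-rot : ∀ x i → i ≤ n → dist x (rot x i) ≡ i ⊓ (n ∸ i)
  dist-rot x i i≤n with ℕ.m≤n⇒m<n∨m≡n i≤n
  ... | inj₂ refl = trans (dist-least n (cycleAdj n) x (rot x n) 0 (ℕ.≤-<-trans z≤n (toℕ<n x)) (within-backward 0 x n ℕ.≤-refl (ℕ.≤-reflexive (sym (ℕ.+-identityʳ n)))) λ _ ())
                     (sym (trans (cong (n ⊓_) (ℕ.n∸n≡0 n)) (ℕ.⊓-zeroʳ n)))
  ... | inj₁ i<n = dist-least n (cycleAdj n) x (rot x i) (i ⊓ (n ∸ i)) (ℕ.≤-<-trans (ℕ.m⊓n≤m i (n ∸ i)) i<n) reach least
    where
    reach : IsTrue (within (i ⊓ (n ∸ i)) x (rot x i))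
    reach with ℕ.⊓-sel i (n ∸ i)
    ... | inj₁ e = subst (λ t → IsTrue (within t x (rot x i))) (sym e) (within-forward i x i ℕ.≤-refl)
    ... | inj₂ e = subst (λ t → IsTrue (within t x (rot x i))) (sym e)
                     (within-backward (n ∸ i) x i i≤n (ℕ.≤-reflexive (sym (ℕ.m+[n∸m]≡n i≤n))))
    least : ∀ s → s < i ⊓ (n ∸ i) → ¬ IsTrue (within s x (rot x i))
    least s s< w with within-sound s x i i<n w
    ... | inj₁ p = ℕ.<⇒≱ s< (ℕ.≤-trans (ℕ.m⊓n≤m i (n ∸ i)) p)
    ... | inj₂ p = ℕ.<⇒≱ s< (ℕ.≤-trans (ℕ.m⊓n≤n i (n ∸ i)) (ℕ.≤-trans (ℕ.∸-monoˡ-≤ i p) (ℕ.≤-reflexive (ℕ.m+n∸m≡n i s))))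

-- Boolean tests and sums over vertex tuples

∧-true : ∀ {a b} → a ∧ b ≡ true → a ≡ true × b ≡ true
∧-true {true} {true} _ = refl , refl

≡ᵇ-iff : ∀ a b c d → (a ≡ b → c ≡ d) → (c ≡ d → a ≡ b) → (a ≡ᵇ b) ≡ (c ≡ᵇ d)
≡ᵇ-iff a b c d f g with a ≡ᵇ b in p | c ≡ᵇ d in q
... | true  | true  = refl
... | false | false = refl
... | true  | false = ⊥-elim (subst IsTrue q (ℕ.≡⇒≡ᵇ c d (f (ℕ.≡ᵇ⇒≡ a b (subst IsTrue (sym p) _)))))
... | false | true  = ⊥-elim (subst IsTrue p (ℕ.≡⇒≡ᵇ a b (g (ℕ.≡ᵇ⇒≡ c d (subst IsTrue (sym q) _)))))

≡ᵇ-refl : ∀ {a b} → a ≡ b → (a ≡ᵇ b) ≡ true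
≡ᵇ-refl {a} refl = trans (≡ᵇ-iff a a 0 0 (λ _ → refl) (λ _ → refl)) refl

≡ᵇ-≢ : ∀ {a b} → a ≢ b → (a ≡ᵇ b) ≡ false
≡ᵇ-≢ {a} {b} ne = ≡ᵇ-iff a b 0 1 (λ e → ⊥-elim (ne e)) (λ ())

⌊⌋-∷ : ∀ {n k} (a b : Fin n) (v w : Vec (Fin n) k) →
  ⌊ ≡-dec _≟_ (a ∷ v) (b ∷ w) ⌋ ≡ ⌊ a ≟ b ⌋ ∧ ⌊ ≡-dec _≟_ v w ⌋
⌊⌋-∷ a b v w with a ≟ b | ≡-dec _≟_ v w
... | yes _ | yes _ = refl
... | yes _ | no  _ = refl
... | no  _ | yes _ = refl
... | no  _ | no  _ = refl

module _ {n : ℕ} where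

  open import Data.Integer.Properties using (+-identityʳ)

  private
    V : ℕ → Set
    V = Vec (Fin n)

    _≟ⱽ_ : ∀ {k} (v w : V k) → Dec (v ≡ w)
    _≟ⱽ_ = ≡-dec _≟_

  ΣV-suc : ∀ k (F : V (suc k) → ℤ) →
    ΣL (allVecs n (suc k)) F ≡ ΣL (allVecs n k) (λ v → ΣF n (λ a → F (a ∷ v)))
  ΣV-suc k F = trans (ΣL-concatMap (λ v → map (λ x → x ∷ v) (allFin n)) (allVecs n k) F)
    (ΣL-cong (allVecs n k) λ v → ΣL-map (λ x → x ∷ v) (allFin n) F)

  ΣV-delta : ∀ k (y : V k) (F : V k → ℤ) → ΣL (allVecs n k) (λ x → when ⌊ x ≟ⱽ y ⌋ (F x)) ≡ F y
  ΣV-delta zero    []       F = +-identityʳ _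
  ΣV-delta (suc k) (y ∷ ys) F = begin
    ΣL (allVecs n (suc k)) (λ x → when ⌊ x ≟ⱽ (y ∷ ys) ⌋ (F x))
      ≡⟨ ΣV-suc k _ ⟩
    ΣL (allVecs n k) (λ v → ΣF n λ a → when ⌊ (a ∷ v) ≟ⱽ (y ∷ ys) ⌋ (F (a ∷ v)))
      ≡⟨ ΣL-cong (allVecs n k) (λ v → trans
           (ΣL-cong (allFin n) λ a → trans (cong (λ b → when b (F (a ∷ v))) (⌊⌋-∷ a y v ys)) (when-∧ ⌊ a ≟ y ⌋ _ _))
           (ΣF-delta n y λ a → when ⌊ v ≟ⱽ ys ⌋ (F (a ∷ v)))) ⟩
    ΣL (allVecs n k) (λ v → when ⌊ v ≟ⱽ ys ⌋ (F (y ∷ v)))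
      ≡⟨ ΣV-delta k ys (F ∘ (y ∷_)) ⟩
    F (y ∷ ys) ∎

  removeAt-suc : ∀ {k} (a : Fin n) (v : V (suc k)) i → removeAt (a ∷ v) (suc i) ≡ a ∷ removeAt v i
  removeAt-suc a (_ ∷ _) i = refl

  -- The tuples whose i-th face is y are exactly the insertions of one vertex into y at i, so the
  -- sum over all tuples collapses to one over vertices.
  ΣV-removeAt : ∀ k i (y : V k) (F : V (suc k) → ℤ) →
    ΣL (allVecs n (suc k)) (λ x → when ⌊ removeAt x i ≟ⱽ y ⌋ (F x)) ≡ ΣF n (λ v → F (insertAt y i v))
  ΣV-removeAt k zero y F = begin
    ΣL (allVecs n (suc k)) (λ x → when ⌊ removeAt x zero ≟ⱽ y ⌋ (F x))
      ≡⟨ ΣV-suc k _ ⟩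
    ΣL (allVecs n k) (λ v → ΣF n λ a → when ⌊ v ≟ⱽ y ⌋ (F (a ∷ v)))
      ≡⟨ ΣL-cong (allVecs n k) (λ v → when-Σ (allFin n) ⌊ v ≟ⱽ y ⌋ λ a → F (a ∷ v)) ⟩
    ΣL (allVecs n k) (λ v → when ⌊ v ≟ⱽ y ⌋ (ΣF n λ a → F (a ∷ v)))
      ≡⟨ ΣV-delta k y (λ v → ΣF n λ a → F (a ∷ v)) ⟩
    ΣF n (λ a → F (a ∷ y)) ∎
  ΣV-removeAt (suc k) (suc i) (y ∷ ys) F = begin
    ΣL (allVecs n (suc (suc k))) (λ x → when ⌊ removeAt x (suc i) ≟ⱽ (y ∷ ys) ⌋ (F x))
      ≡⟨ ΣV-suc (suc k) _ ⟩
    ΣL (allVecs n (suc k)) (λ v → ΣF n λ a → when ⌊ removeAt (a ∷ v) (suc i) ≟ⱽ (y ∷ ys) ⌋ (F (a ∷ v)))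
      ≡⟨ ΣL-cong (allVecs n (suc k)) (λ v → trans
           (ΣL-cong (allFin n) λ a → trans
             (cong (λ b → when b (F (a ∷ v))) (trans (cong (λ z → ⌊ z ≟ⱽ (y ∷ ys) ⌋) (removeAt-suc a v i)) (⌊⌋-∷ a y (removeAt v i) ys)))
             (when-∧ ⌊ a ≟ y ⌋ _ _))
           (ΣF-delta n y λ a → when ⌊ removeAt v i ≟ⱽ ys ⌋ (F (a ∷ v)))) ⟩
    ΣL (allVecs n (suc k)) (λ v → when ⌊ removeAt v i ≟ⱽ ys ⌋ (F (y ∷ v)))
      ≡⟨ ΣV-removeAt k i ys (F ∘ (y ∷_)) ⟩
    ΣF n (λ v → F (y ∷ insertAt ys i v)) ∎

-- The magnitude differential as a sum over inserted vertices

module Differential (n : ℕ) (adj : Fin n → Fin n → Bool) where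

  open import Data.Integer using (_+_; _*_; -_)
  open import Data.Integer.Properties using (*-zeroʳ; neg-distrib-+; neg-distribˡ-*; -1*i≡-i)

  open MC n adj

  -- Recursion on y in the shape of `∂` on words: the new vertex goes between the first two entries
  -- or further along, and each position passed contributes a sign.
  D : ∀ {k} → Chain (suc k) → Chain k
  D         c (y ∷ [])      = 0ℤ
  D {suc k} c (y ∷ y′ ∷ ys) =
    - (ΣF n (λ v → when (dist y v ℕ.+ dist v y′ ≡ᵇ dist y y′) (c (y ∷ v ∷ y′ ∷ ys))) + D (λ z → c (y ∷ z)) (y′ ∷ ys))

  private
    ins : ∀ {k} → Chain (suc k) → Vec (Fin n) (suc k) → Fin k → ℤ
    ins c y j = ΣF n λ v →
      let x = insertAt y (suc (inject₁ j)) v in when (len y ≡ᵇ len x) (sgn (suc (toℕ j)) * c x)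

    Ins : ∀ {k} → Chain (suc k) → Chain k
    Ins {k} c y = ΣF k (ins c y)

    when-neg : ∀ b x → when b (- x) ≡ - when b x
    when-neg true  x = refl
    when-neg false x = refl

    Ins≡D : ∀ {k} (c : Chain (suc k)) y → Ins c y ≡ D c y
    Ins≡D {zero}  c (y ∷ [])      = refl
    Ins≡D {suc k} c (y ∷ y′ ∷ ys) = begin
      Ins c (y ∷ y′ ∷ ys)
        ≡⟨ ΣF-suc k (ins c (y ∷ y′ ∷ ys)) ⟩
      ins c (y ∷ y′ ∷ ys) zero + ΣF k (ins c (y ∷ y′ ∷ ys) ∘ suc)
        ≡⟨ cong₂ _+_ (trans (ΣL-cong (allFin n) head-term) (ΣL-neg (allFin n) h))
             (trans (ΣL-cong (allFin k) λ j → trans (ΣL-cong (allFin n) (tail-term j)) (ΣL-neg (allFin n) _))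
               (ΣL-neg (allFin k) (ins c′ (y′ ∷ ys)))) ⟩
      - ΣF n h + - Ins c′ (y′ ∷ ys)
        ≡⟨ neg-distrib-+ (ΣF n h) (Ins c′ (y′ ∷ ys)) ⟨
      - (ΣF n h + Ins c′ (y′ ∷ ys))
        ≡⟨ cong (λ z → - (ΣF n h + z)) (Ins≡D c′ (y′ ∷ ys)) ⟩
      D c (y ∷ y′ ∷ ys) ∎
      where
      c′ : Chain (suc k)
      c′ z = c (y ∷ z)
      h : Fin n → ℤ
      h v = when (dist y v ℕ.+ dist v y′ ≡ᵇ dist y y′) (c (y ∷ v ∷ y′ ∷ ys))
      R = len (y′ ∷ ys)
      head-term : ∀ v → when (len (y ∷ y′ ∷ ys) ≡ᵇ len (y ∷ v ∷ y′ ∷ ys)) (- 1ℤ * c (y ∷ v ∷ y′ ∷ ys))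
        ≡ - when (dist y v ℕ.+ dist v y′ ≡ᵇ dist y y′) (c (y ∷ v ∷ y′ ∷ ys))
      head-term v = trans
        (cong₂ when (≡ᵇ-iff (dist y y′ ℕ.+ R) (dist y v ℕ.+ (dist v y′ ℕ.+ R)) (dist y v ℕ.+ dist v y′) (dist y y′)
            (λ e → sym (ℕ.+-cancelʳ-≡ R (dist y y′) _ (trans e (sym (ℕ.+-assoc (dist y v) (dist v y′) R)))))
            (λ e → trans (cong (ℕ._+ R) (sym e)) (ℕ.+-assoc (dist y v) (dist v y′) R)))
          (-1*i≡-i (c (y ∷ v ∷ y′ ∷ ys))))
        (when-neg (dist y v ℕ.+ dist v y′ ≡ᵇ dist y y′) _)
      tail-term : ∀ j v → let x = insertAt (y′ ∷ ys) (suc (inject₁ j)) v in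
        when (len (y ∷ y′ ∷ ys) ≡ᵇ len (y ∷ x)) (- sgn (suc (toℕ j)) * c (y ∷ x))
          ≡ - when (len (y′ ∷ ys) ≡ᵇ len x) (sgn (suc (toℕ j)) * c (y ∷ x))
      tail-term j v = let x = insertAt (y′ ∷ ys) (suc (inject₁ j)) v in trans
        (cong₂ when (≡ᵇ-iff (dist y y′ ℕ.+ R) (dist y y′ ℕ.+ len x) R (len x) (ℕ.+-cancelˡ-≡ (dist y y′) R (len x)) (cong (dist y y′ ℕ.+_)))
          (sym (neg-distribˡ-* (sgn (suc (toℕ j))) (c (y ∷ x)))))
        (when-neg (R ≡ᵇ len x) _)

  -- Validity makes c zero wherever `gen` fails, so the support of c takes over that test; the face
  -- condition then turns into insertion of a vertex into y.
  ∂≡D : ∀ k l (c : Chain (suc k)) → Valid (suc k) l c → ∀ y → ∂ k l c y ≡ D c y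
  ∂≡D k l c valid y = begin
    ∂ k l c y
      ≡⟨ ΣL-cong (allVecs n (suc (suc k))) (λ x → ΣL-cong (allFin k) (term x)) ⟩
    ΣL (allVecs n (suc (suc k))) (λ x → ΣF k λ j → F j x)
      ≡⟨ ΣL-comm (allVecs n (suc (suc k))) (allFin k) (λ x j → F j x) ⟩
    ΣF k (λ j → ΣL (allVecs n (suc (suc k))) (F j))
      ≡⟨ ΣL-cong (allFin k) (λ j → ΣV-removeAt (suc k) (suc (inject₁ j)) y (G j)) ⟩
    Ins c y
      ≡⟨ Ins≡D c y ⟩
    D c y ∎
    where
    G : Fin k → Vec (Fin n) (suc (suc k)) → ℤ
    G j x = when (len y ≡ᵇ len x) (sgn (suc (toℕ j)) * c x)
    F : Fin k → Vec (Fin n) (suc (suc k)) → ℤ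
    F j x = when ⌊ ≡-dec _≟_ (removeAt x (suc (inject₁ j))) y ⌋ (G j x)
    term : ∀ x j → let f = removeAt x (suc (inject₁ j)) in
      (if gen (suc k) l x ∧ (len f ≡ᵇ len x) ∧ ⌊ ≡-dec _≟_ f y ⌋ then sgn (suc (toℕ j)) * c x else 0ℤ) ≡ F j x
    term x j with ≡-dec _≟_ (removeAt x (suc (inject₁ j))) y | gen (suc k) l x in g
    ... | no  _ | true  with len (removeAt x (suc (inject₁ j))) ≡ᵇ len x
    ...   | true  = refl
    ...   | false = refl
    term x j | no _ | false = refl
    term x j | yes refl | false = sym (trans (cong (λ z → when (len (removeAt x (suc (inject₁ j))) ≡ᵇ len x) (sgn (suc (toℕ j)) * z)) (valid x g))
      (trans (cong (when _) (*-zeroʳ (sgn (suc (toℕ j))))) (when-0 (len (removeAt x (suc (inject₁ j))) ≡ᵇ len x))))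
    term x j | yes refl | true with len (removeAt x (suc (inject₁ j))) ≡ᵇ len x
    ...   | true  = refl
    ...   | false = refl

  module _ (dist-self : ∀ x → dist x x ≡ 0) (dist-pos : ∀ {x y} → dist x y ≡ 0 → x ≡ y) where

    private
      not-≟ : ∀ {x y : Fin n} → x ≢ y → not ⌊ x ≟ y ⌋ ≡ true
      not-≟ {x} {y} ne with x ≟ y
      ... | yes e = ⊥-elim (ne e)
      ... | no _  = refl

      ≟-not : ∀ {x y : Fin n} → not ⌊ x ≟ y ⌋ ≡ true → x ≢ y
      ≟-not {x} {y} h with x ≟ y
      ≟-not () | yes _
      ... | no ne = ne

    -- If the two neighbours of the removed vertex coincided, equality of lengths would force the
    -- distance from the first neighbour to the removed vertex to be 0.
    noRep-removeAt : ∀ {k} (x : Vec (Fin n) (suc (suc k))) (j : Fin k) → noRep x ≡ true →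
      len (removeAt x (suc (inject₁ j))) ≡ len x → noRep (removeAt x (suc (inject₁ j))) ≡ true
    noRep-removeAt (a ∷ b ∷ c ∷ r) zero h e with ∧-true {not ⌊ a ≟ b ⌋} h
    ... | a≢b , h′ = cong₂ _∧_ (not-≟ a≢c) (proj₂ (∧-true {not ⌊ b ≟ c ⌋} h′))
      where
      R = len (c ∷ r)
      e′ : dist a c ≡ dist a b ℕ.+ dist b c
      e′ = ℕ.+-cancelʳ-≡ R _ _ (trans e (sym (ℕ.+-assoc (dist a b) (dist b c) R)))
      a≢c : a ≢ c
      a≢c refl = ≟-not a≢b (dist-pos (ℕ.m+n≡0⇒m≡0 (dist a b) (trans (sym e′) (dist-self a))))
    noRep-removeAt (a ∷ b ∷ c ∷ r) (suc j) h e with ∧-true {not ⌊ a ≟ b ⌋} h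
    ... | a≢b , h′ = cong₂ _∧_ a≢b (noRep-removeAt (b ∷ c ∷ r) j h′ (ℕ.+-cancelˡ-≡ (dist a b) _ _ e))

    ∂-valid : ∀ k l (c : Chain (suc k)) → Valid k l (∂ k l c)
    ∂-valid k l c y ¬gen = ΣL-zero (allVecs n (suc (suc k))) λ x → ΣL-zero (allFin k) (term x)
      where
      term : ∀ x j → let f = removeAt x (suc (inject₁ j)) in
        (if gen (suc k) l x ∧ (len f ≡ᵇ len x) ∧ ⌊ ≡-dec _≟_ f y ⌋ then sgn (suc (toℕ j)) * c x else 0ℤ) ≡ 0ℤ
      term x j with ≡-dec _≟_ (removeAt x (suc (inject₁ j))) y | gen (suc k) l x in g
      ... | yes e | false = refl
      ... | no  _ | false = refl
      ... | no  _ | true  with len (removeAt x (suc (inject₁ j))) ≡ᵇ len x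
      ...   | true  = refl
      ...   | false = refl
      term x j | yes refl | true with len (removeAt x (suc (inject₁ j))) ≡ᵇ len x in q
      ...   | false = refl
      ...   | true  with ∧-true {noRep x} g
      ...     | nr , lx with trans (sym ¬gen) (cong₂ _∧_ (noRep-removeAt x j nr len≡)
                  (trans (cong (_≡ᵇ l) len≡) lx))
        where len≡ = ℕ.≡ᵇ⇒≡ (len (removeAt x (suc (inject₁ j)))) (len x) (subst IsTrue (sym q) _)
      ...       | ()

-- Vertex tuples as words of displacements

module Tuples (N n : ℕ) .{{_ : NonZero n}} (n≡m+m : n ≡ suc (suc N) ℕ.+ suc (suc N)) where

  open import Data.Integer using (_+_; _*_; -_)
  open import Data.Integer.Properties using (+-identityˡ; *-zeroˡ; *-zeroʳ; *-identityʳ; i*j≡0⇒i≡0∨j≡0)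
  open Words N

  m : ℕ
  m = suc M

  m≤n : m ≤ n
  m≤n = subst (m ≤_) (sym n≡m+m) (ℕ.m≤m+n m m)

  n∸m≡m : n ∸ m ≡ m
  n∸m≡m = trans (cong (_∸ m) n≡m+m) (ℕ.m+n∸m≡n m m)

  open Rotation n
  open MC n (cycleAdj n) renaming (∂ to ∂ᴹ)
  open Differential n (cycleAdj n)

  adv : Bool → Fin n → ℕ → Fin n
  adv false x i = rot x i
  adv true  x i = rot x (n ∸ i)

  adv-adv : ∀ d x i j → i ℕ.+ j ≤ n → adv d (adv d x i) j ≡ adv d x (i ℕ.+ j)
  adv-adv false x i j _ = rot-rot x i j
  adv-adv true  x i j h = begin
    rot (rot x (n ∸ i)) (n ∸ j)         ≡⟨ rot-rot x (n ∸ i) (n ∸ j) ⟩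
    rot x ((n ∸ i) ℕ.+ (n ∸ j))         ≡⟨ cong (rot x) eq ⟩
    rot x ((n ∸ (i ℕ.+ j)) ℕ.+ n)       ≡⟨ rot-rot x (n ∸ (i ℕ.+ j)) n ⟨
    rot (rot x (n ∸ (i ℕ.+ j))) n       ≡⟨ rot-n _ ⟩
    rot x (n ∸ (i ℕ.+ j)) ∎
    where
    j≤n∸i : j ≤ n ∸ i
    j≤n∸i = ℕ.≤-trans (ℕ.≤-reflexive (sym (ℕ.m+n∸m≡n i j))) (ℕ.∸-monoˡ-≤ i h)
    eq : (n ∸ i) ℕ.+ (n ∸ j) ≡ (n ∸ (i ℕ.+ j)) ℕ.+ n
    eq = begin
      (n ∸ i) ℕ.+ (n ∸ j)                 ≡⟨ cong (ℕ._+ (n ∸ j)) (ℕ.m∸n+n≡m j≤n∸i) ⟨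
      (n ∸ i ∸ j) ℕ.+ j ℕ.+ (n ∸ j)       ≡⟨ ℕ.+-assoc (n ∸ i ∸ j) j (n ∸ j) ⟩
      (n ∸ i ∸ j) ℕ.+ (j ℕ.+ (n ∸ j))     ≡⟨ cong₂ ℕ._+_ (ℕ.∸-+-assoc n i j) (ℕ.m+[n∸m]≡n (ℕ.≤-trans (ℕ.m≤n+m j i) h)) ⟩
      (n ∸ (i ℕ.+ j)) ℕ.+ n ∎

  adv-flip : ∀ d x i → i ≤ n → adv (not d) x i ≡ adv d x (n ∸ i)
  adv-flip false x i _ = refl
  adv-flip true  x i h = cong (rot x) (sym (ℕ.m∸[m∸n]≡n h))

  dist-adv : ∀ d x i → i ≤ n → dist x (adv d x i) ≡ i ⊓ (n ∸ i)
  dist-adv false x i h = dist-rot x i h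
  dist-adv true  x i h = begin
    dist x (rot x (n ∸ i))      ≡⟨ dist-rot x (n ∸ i) (ℕ.m∸n≤m n i) ⟩
    (n ∸ i) ⊓ (n ∸ (n ∸ i))     ≡⟨ cong ((n ∸ i) ⊓_) (ℕ.m∸[m∸n]≡n h) ⟩
    (n ∸ i) ⊓ i                 ≡⟨ ℕ.⊓-comm (n ∸ i) i ⟩
    i ⊓ (n ∸ i) ∎

  dist-adv-small : ∀ d x i → i ≤ m → dist x (adv d x i) ≡ i
  dist-adv-small d x i h = trans (dist-adv d x i (ℕ.≤-trans h m≤n))
    (ℕ.m≤n⇒m⊓n≡m (ℕ.≤-trans h (ℕ.≤-trans (ℕ.≤-reflexive (sym n∸m≡m)) (ℕ.∸-monoʳ-≤ n h))))

  dist-self : ∀ x → dist x x ≡ 0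
  dist-self x = trans (cong (dist x) (sym (rot-0 x))) (dist-rot x 0 z≤n)

  dist-pos : ∀ {x y} → dist x y ≡ 0 → x ≡ y
  dist-pos {x} {y} h with off x y | off<n x y | rot-off x y
  ... | i | i<n | refl with ℕ.⊓-sel i (n ∸ i)
  ...   | inj₁ e = sym (trans (cong (rot x) (trans (sym e) (trans (sym (dist-rot x i (ℕ.<⇒≤ i<n))) h))) (rot-0 x))
  ...   | inj₂ e = ⊥-elim (ℕ.<⇒≢ (ℕ.m<n⇒0<n∸m i<n) (sym (trans (sym e) (trans (sym (dist-rot x i (ℕ.<⇒≤ i<n))) h))))

  step : Fin n → Letter → Fin n
  step x (ℓ d i) = adv d x (suc i)
  step x C       = adv false x m

  adv-m : ∀ d x → adv d x m ≡ step x C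
  adv-m false x = refl
  adv-m true  x = cong (rot x) n∸m≡m

  dist-step : ∀ x s → GoodL s → dist x (step x s) ≡ wtL s
  dist-step x (ℓ d i) g = dist-adv-small d x (suc i) (ℕ.≤-trans g (ℕ.n≤1+n M))
  dist-step x C       _ = dist-adv-small false x m ℕ.≤-refl

  wtL-pos : ∀ s → 0 < wtL s
  wtL-pos (ℓ d i) = s≤s z≤n
  wtL-pos C       = s≤s z≤n

  step-≢ : ∀ x s → GoodL s → x ≢ step x s
  step-≢ x s g e = ℕ.<⇒≢ (wtL-pos s) (trans (sym (trans (cong (dist x) (sym e)) (dist-self x))) (dist-step x s g))

  adv-split : ∀ d x {p j} → j < p → p ≤ M → step (step x (ℓ d j)) (ℓ d (p ∸ suc j)) ≡ adv d x (suc p)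
  adv-split d x {p} {j} j<p p≤M = trans
    (adv-adv d x (suc j) (suc (p ∸ suc j)) (ℕ.≤-trans (ℕ.≤-reflexive (wt-split j<p)) (ℕ.≤-trans (s≤s p≤M) m≤n)))
    (cong (adv d x) (wt-split j<p))

  -- Separated from `path` so that `tup x w` exposes its first vertex for every w, which lets `len`,
  -- `noRep` and `D` compute on it.
  tup : ∀ {k} → Fin n → Vec Letter k → Vec (Fin n) (suc k)
  path : ∀ {k} → Fin n → Vec Letter k → Vec (Fin n) k
  tup x w = x ∷ path x w
  path x []      = []
  path x (s ∷ w) = tup (step x s) w

  len-tup : ∀ {k} x (w : Vec Letter k) → Good w → len (tup x w) ≡ wt w
  len-tup x []      _         = refl
  len-tup x (s ∷ w) (gs , gw) = cong₂ ℕ._+_ (dist-step x s gs) (len-tup (step x s) w gw)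

  noRep-tup : ∀ {k} x (w : Vec Letter k) → Good w → noRep (tup x w) ≡ true
  noRep-tup x []      _         = refl
  noRep-tup x (s ∷ w) (gs , gw) with x ≟ step x s
  ... | yes e = ⊥-elim (step-≢ x s gs e)
  ... | no  _ = noRep-tup (step x s) w gw

  gen-tup : ∀ {k} l x (w : Vec Letter k) → Good w → gen k l (tup x w) ≡ (wt w ≡ᵇ l)
  gen-tup l x w gw = cong₂ _∧_ (noRep-tup x w gw) (cong (_≡ᵇ l) (len-tup x w gw))

  disp : Letter → ℕ
  disp (ℓ false i) = suc i
  disp (ℓ true  i) = n ∸ suc i
  disp C           = m

  step-disp : ∀ x s → step x s ≡ rot x (disp s)
  step-disp x (ℓ false i) = refl
  step-disp x (ℓ true  i) = refl
  step-disp x C           = refl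

  -- `decode 0` is a junk value.
  decode : ℕ → Letter
  decode zero = C
  decode (suc i) with ℕ.<-cmp i M
  ... | tri< _ _ _ = ℓ false i
  ... | tri≈ _ _ _ = C
  ... | tri> _ _ _ = ℓ true (n ∸ suc (suc i))

  m<n : m < n
  m<n = subst (m <_) (sym n≡m+m) (ℕ.m<m+n m (s≤s z≤n))

  disp<n : ∀ s → GoodL s → disp s < n
  disp<n (ℓ false i) g = ℕ.<-≤-trans (s≤s g) m≤n
  disp<n (ℓ true  i) g = ℕ.∸-monoʳ-< {n} {suc i} {0} (s≤s z≤n) (ℕ.≤-trans g (ℕ.≤-trans (ℕ.n≤1+n M) m≤n))
  disp<n C           _ = m<n

  decode-< : ∀ {i} → i < M → decode (suc i) ≡ ℓ false i
  decode-< {i} h with ℕ.<-cmp i M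
  ... | tri< _ _ _ = refl
  ... | tri≈ ¬p _ _ = ⊥-elim (¬p h)
  ... | tri> ¬p _ _ = ⊥-elim (¬p h)

  decode-≡ : decode m ≡ C
  decode-≡ with ℕ.<-cmp M M
  ... | tri< _ ¬p _ = ⊥-elim (¬p refl)
  ... | tri≈ _ _ _ = refl
  ... | tri> _ ¬p _ = ⊥-elim (¬p refl)

  decode-> : ∀ {i} → M < i → decode (suc i) ≡ ℓ true (n ∸ suc (suc i))
  decode-> {i} h with ℕ.<-cmp i M
  ... | tri< _ _ ¬p = ⊥-elim (¬p h)
  ... | tri≈ _ _ ¬p = ⊥-elim (¬p h)
  ... | tri> _ _ _ = refl

  decode-disp : ∀ s → GoodL s → decode (disp s) ≡ s
  decode-disp (ℓ false i) g = decode-< g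
  decode-disp C           _ = decode-≡
  decode-disp (ℓ true  i) g = begin
    decode (n ∸ suc i)                       ≡⟨ cong decode eq ⟩
    decode (suc (n ∸ suc (suc i)))           ≡⟨ decode-> big ⟩
    ℓ true (n ∸ suc (suc (n ∸ suc (suc i)))) ≡⟨ cong (λ z → ℓ true (n ∸ suc z)) (sym eq) ⟩
    ℓ true (n ∸ suc (n ∸ suc i))             ≡⟨ cong (ℓ true) (trans (sym (ℕ.pred[m∸n]≡m∸[1+n] n (n ∸ suc i))) (cong ℕ.pred (ℕ.m∸[m∸n]≡n (ℕ.<⇒≤ i<n)))) ⟩
    ℓ true i ∎
    where
    i<n : suc i < n
    i<n = ℕ.<-≤-trans (s≤s g) m≤n
    eq : n ∸ suc i ≡ suc (n ∸ suc (suc i))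
    eq = ℕ.+-∸-assoc 1 i<n
    big : M < n ∸ suc (suc i)
    big = ℕ.≤-trans (ℕ.≤-reflexive (sym n∸m≡m)) (ℕ.∸-monoʳ-≤ n (s≤s g))

  decode-good : ∀ i → suc i < n → GoodL (decode (suc i))
  decode-good i i<n with ℕ.<-cmp i M
  ... | tri< p _ _ = p
  ... | tri≈ _ _ _ = tt
  ... | tri> _ _ p = ℕ.≤-trans (ℕ.≤-reflexive (sym (ℕ.+-∸-assoc 1 i<n)))
    (ℕ.≤-trans (ℕ.∸-monoʳ-≤ n (s≤s p)) (ℕ.≤-reflexive (trans (sym (ℕ.pred[m∸n]≡m∸[1+n] n m)) (cong ℕ.pred n∸m≡m))))

  disp-decode : ∀ i → suc i < n → disp (decode (suc i)) ≡ suc i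
  disp-decode i i<n with ℕ.<-cmp i M
  ... | tri< _ _ _    = refl
  ... | tri≈ _ refl _ = refl
  ... | tri> _ _ _    = trans (cong (n ∸_) (sym (ℕ.+-∸-assoc 1 i<n))) (ℕ.m∸[m∸n]≡n (ℕ.<⇒≤ i<n))

  letter : Fin n → Fin n → Letter
  letter x y = decode (off x y)

  letter-step : ∀ x s → GoodL s → letter x (step x s) ≡ s
  letter-step x s g = trans (cong decode (trans (cong (off x) (step-disp x s)) (off-rot x (disp<n s g)))) (decode-disp s g)

  step-letter : ∀ x y → x ≢ y → GoodL (letter x y) × step x (letter x y) ≡ y
  step-letter x y ne with off x y | off<n x y | rot-off x y
  ... | zero  | _   | e = ⊥-elim (ne (trans (sym (rot-0 x)) e))
  ... | suc i | i<n | e = decode-good i i<n ,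
    trans (step-disp x (decode (suc i))) (trans (cong (rot x) (disp-decode i i<n)) e)

  dec : ∀ {k} → Fin n → Vec (Fin n) k → Vec Letter k
  dec x []       = []
  dec x (y ∷ ys) = letter x y ∷ dec y ys

  dec-path : ∀ {k} x (w : Vec Letter k) → Good w → dec x (path x w) ≡ w
  dec-path x []      _         = refl
  dec-path x (s ∷ w) (gs , gw) = cong₂ _∷_ (letter-step x s gs) (dec-path (step x s) w gw)

  path-dec : ∀ {k} x (ys : Vec (Fin n) k) → noRep (x ∷ ys) ≡ true → Good (dec x ys) × path x (dec x ys) ≡ ys
  path-dec x []       _ = tt , refl
  path-dec x (y ∷ ys) h with x ≟ y
  path-dec x (y ∷ ys) () | yes _
  ... | no ne with step-letter x y ne | path-dec y ys h
  ...   | g , e | gs , es = (g , gs) , trans (cong (λ z → z ∷ path z (dec y ys)) e) (cong (y ∷_) es)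

  -- Reindexing along the bijection from offsets to vertices: a delta is inserted and the two sums
  -- are exchanged.
  ΣF-rot : ∀ x (F : Fin n → ℤ) → ΣF n F ≡ Σ< n (λ i → F (rot x i))
  ΣF-rot x F = begin
    ΣF n F
      ≡⟨ ΣL-cong (allFin n) (λ v → ΣF-delta n (offF v) (λ _ → F v)) ⟨
    ΣF n (λ v → ΣF n (λ i → when ⌊ i ≟ offF v ⌋ (F v)))
      ≡⟨ ΣL-comm (allFin n) (allFin n) (λ v i → when ⌊ i ≟ offF v ⌋ (F v)) ⟩
    ΣF n (λ i → ΣF n (λ v → when ⌊ i ≟ offF v ⌋ (F v)))
      ≡⟨ ΣL-cong (allFin n) (λ i → trans
           (ΣL-cong (allFin n) λ v → cong (λ b → when b (F v)) (⌊⌋-iff (i ≟ offF v) (v ≟ rot x (toℕ i)) (to i v) (from i v)))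
           (ΣF-delta n (rot x (toℕ i)) F)) ⟩
    ΣF n (λ i → F (rot x (toℕ i)))
      ≡⟨ ΣF≡Σ< n (λ i → F (rot x i)) ⟩
    Σ< n (λ i → F (rot x i)) ∎
    where
    offF : Fin n → Fin n
    offF v = fromℕ< (off<n x v)
    to : ∀ i v → i ≡ offF v → v ≡ rot x (toℕ i)
    to i v refl = sym (trans (cong (rot x) (toℕ-fromℕ< (off<n x v))) (rot-off x v))
    from : ∀ i v → v ≡ rot x (toℕ i) → i ≡ offF v
    from i v refl = toℕ-injective (sym (trans (toℕ-fromℕ< (off<n x _)) (off-rot x (toℕ<n i))))

  -- Each vertex other than x is `step x s` for exactly one good letter s.
  ΣF-step : ∀ d x (F : Fin n → ℤ) → ΣF n F ≡
    F x + (Σ< M (λ j → F (step x (ℓ d j))) + (F (step x C) + Σ< M (λ j → F (step x (ℓ (not d) j)))))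
  ΣF-step true x F = trans (ΣF-step false x F)
    (cong (F x +_) (alg (Σ< M (λ j → F (step x (ℓ false j)))) (F (step x C)) (Σ< M (λ j → F (step x (ℓ true j))))))
    where
    alg : ∀ a b c → a + (b + c) ≡ c + (b + a)
    alg = solve-∀
  ΣF-step false x F = begin
    ΣF n F
      ≡⟨ trans (ΣF-rot x F) (cong (λ z → Σ< z (λ i → F (rot x i))) n≡m+m) ⟩
    F (rot x 0) + Σ< (M ℕ.+ m) (λ i → F (rot x (suc i)))
      ≡⟨ cong₂ (λ y z → F y + z) (rot-0 x) (Σ<-split M m (λ i → F (rot x (suc i)))) ⟩
    F x + (Σ< M (λ j → F (rot x (suc j))) + Σ< m g)
      ≡⟨ cong (λ z → F x + (Σ< M (λ j → F (rot x (suc j))) + z)) tail ⟩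
    F x + (Σ< M (λ j → F (rot x (suc j))) + (F (rot x m) + Σ< M (λ j → F (step x (ℓ true j))))) ∎
    where
    g : ℕ → ℤ
    g j = F (rot x (suc (M ℕ.+ j)))
    last : ∀ j → j < M → g (suc (M ∸ suc j)) ≡ F (rot x (n ∸ suc j))
    last j j<M = cong (F ∘ rot x) (begin
      suc (M ℕ.+ suc (M ∸ suc j))     ≡⟨ cong (m ℕ.+_) (ℕ.+-∸-assoc 1 j<M) ⟨
      m ℕ.+ (m ∸ suc j)               ≡⟨ ℕ.+-∸-assoc m (ℕ.≤-trans j<M (ℕ.n≤1+n M)) ⟨
      (m ℕ.+ m) ∸ suc j               ≡⟨ cong (_∸ suc j) n≡m+m ⟨
      n ∸ suc j ∎)
    tail : Σ< m g ≡ F (rot x m) + Σ< M (λ j → F (step x (ℓ true j)))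
    tail = cong₂ _+_ (cong (λ z → F (rot x (suc z))) (ℕ.+-identityʳ M))
      (trans (Σ<-reverse M (λ j → g (suc j))) (Σ<-cong M last))

  -- `F` restricts `G` to the vertices on a geodesic from x to `step x s`. Both endpoints pass this
  -- test as well, and there `G` has to vanish by itself.
  module Between {x : Fin n} {s : Letter} (gs : GoodL s) (G : Fin n → ℤ) (Gx : G x ≡ 0ℤ) (Gs : G (step x s) ≡ 0ℤ) where

    F : Fin n → ℤ
    F v = when (dist x v ℕ.+ dist v (step x s) ≡ᵇ dist x (step x s)) (G v)

    F-x : F x ≡ 0ℤ
    F-x = trans (cong (when _) Gx) (when-0 (dist x x ℕ.+ dist x (step x s) ≡ᵇ dist x (step x s)))

    F-false : ∀ v → dist x v ℕ.+ dist v (step x s) ≢ dist x (step x s) → F v ≡ 0ℤ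
    F-false v ne = cong (λ b → when b (G v)) (≡ᵇ-≢ ne)

    -- A vertex at least as far from x as `step x s` lies on such a geodesic only if it is its
    -- endpoint.
    F-far : ∀ t → GoodL t → wtL s ≤ wtL t → F (step x t) ≡ 0ℤ
    F-far t gt le with step x t ≟ step x s
    ... | yes e = trans (cong F e) (trans (cong (when _) Gs)
                    (when-0 (dist x (step x s) ℕ.+ dist (step x s) (step x s) ≡ᵇ dist x (step x s))))
    ... | no ne = F-false (step x t) λ e → ne (dist-pos (ℕ.n≤0⇒n≡0 (ℕ.+-cancelˡ-≤ (wtL t) _ _
        (ℕ.≤-trans (ℕ.≤-reflexive (trans (cong (ℕ._+ dist (step x t) (step x s)) (sym (dist-step x t gt))) (trans e (dist-step x s gs))))
          (ℕ.≤-trans le (ℕ.≤-reflexive (sym (ℕ.+-identityʳ (wtL t)))))))))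

    F-near : ∀ t u → GoodL t → GoodL u → step (step x t) u ≡ step x s → wtL t ℕ.+ wtL u ≡ wtL s → F (step x t) ≡ G (step x t)
    F-near t u gt gu e h = cong (λ b → when b (G (step x t))) (≡ᵇ-refl (begin
      dist x (step x t) ℕ.+ dist (step x t) (step x s) ≡⟨ cong₂ ℕ._+_ (dist-step x t gt) (trans (cong (dist (step x t)) (sym e)) (dist-step (step x t) u gu)) ⟩
      wtL t ℕ.+ wtL u                                  ≡⟨ h ⟩
      wtL s                                            ≡⟨ dist-step x s gs ⟨
      dist x (step x s) ∎))

  -- From the vertex a steps one way to the one b steps the other way, the distance is the smaller
  -- of q = n - a - b and n - q = a + b. A path through the first vertex thus has length n - b or 2a
  -- + b, and both exceed b because b < m.
  opposite : ∀ d x {j p} → j < M → p < M →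
    dist x (step x (ℓ (not d) j)) ℕ.+ dist (step x (ℓ (not d) j)) (step x (ℓ d p)) ≢ dist x (step x (ℓ d p))
  opposite d x {j} {p} j<M p<M h = impossible (ℕ.⊓-sel q (n ∸ q))
    where
    a = suc j
    b = suc p
    q = n ∸ b ∸ a
    v = adv (not d) x a
    a+b≤n : a ℕ.+ b ≤ n
    a+b≤n = ℕ.≤-trans (ℕ.+-mono-≤ (ℕ.≤-trans j<M (ℕ.n≤1+n M)) (ℕ.≤-trans p<M (ℕ.n≤1+n M))) (ℕ.≤-reflexive (sym n≡m+m))
    b≤n : b ≤ n
    b≤n = ℕ.≤-trans (ℕ.m≤n+m b a) a+b≤n
    a≤n∸b : a ≤ n ∸ b
    a≤n∸b = ℕ.m+n≤o⇒m≤o∸n a a+b≤n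
    a+q : a ℕ.+ q ≡ n ∸ b
    a+q = ℕ.m+[n∸m]≡n a≤n∸b
    target : adv (not d) v q ≡ step x (ℓ d p)
    target = begin
      adv (not d) (adv (not d) x a) q ≡⟨ adv-adv (not d) x a q (ℕ.≤-trans (ℕ.≤-reflexive a+q) (ℕ.m∸n≤m n b)) ⟩
      adv (not d) x (a ℕ.+ q)         ≡⟨ cong (adv (not d) x) a+q ⟩
      adv (not d) x (n ∸ b)           ≡⟨ adv-flip d x (n ∸ b) (ℕ.m∸n≤m n b) ⟩
      adv d x (n ∸ (n ∸ b))           ≡⟨ cong (adv d x) (ℕ.m∸[m∸n]≡n b≤n) ⟩
      adv d x b ∎
    q≤n : q ≤ n
    q≤n = ℕ.≤-trans (ℕ.m∸n≤m (n ∸ b) a) (ℕ.m∸n≤m n b)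
    h′ : a ℕ.+ (q ⊓ (n ∸ q)) ≡ b
    h′ = begin
      a ℕ.+ (q ⊓ (n ∸ q)) ≡⟨ cong₂ ℕ._+_ (dist-step x (ℓ (not d) j) j<M) (trans (cong (dist v) (sym target)) (dist-adv (not d) v q q≤n)) ⟨
      dist x v ℕ.+ dist v (step x (ℓ d p)) ≡⟨ h ⟩
      dist x (step x (ℓ d p)) ≡⟨ dist-step x (ℓ d p) p<M ⟩
      b ∎
    impossible : q ⊓ (n ∸ q) ≡ q ⊎ q ⊓ (n ∸ q) ≡ n ∸ q → _
    impossible (inj₁ e) = ℕ.<⇒≱ {b} {m} (s≤s p<M)
      (ℕ.≤-trans (ℕ.≤-reflexive (sym n∸m≡m)) (ℕ.≤-trans (ℕ.∸-monoʳ-≤ n (ℕ.≤-trans p<M (ℕ.n≤1+n M)))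
        (ℕ.≤-reflexive (trans (sym a+q) (trans (cong (a ℕ.+_) (sym e)) h′)))))
    impossible (inj₂ e) = ℕ.<⇒≢ (ℕ.<-≤-trans (s≤s (ℕ.m≤n+m b j)) (ℕ.m≤m+n (a ℕ.+ b) a))
      (sym (trans (sym n∸q′) (trans (cong (a ℕ.+_) (sym e)) h′)))
      where
      n∸q : n ∸ q ≡ a ℕ.+ b
      n∸q = trans (cong (n ∸_) (ℕ.∸-+-assoc n b a)) (trans (ℕ.m∸[m∸n]≡n (subst (_≤ n) (ℕ.+-comm a b) a+b≤n)) (ℕ.+-comm b a))
      n∸q′ : a ℕ.+ (n ∸ q) ≡ a ℕ.+ b ℕ.+ a
      n∸q′ = trans (cong (a ℕ.+_) n∸q) (ℕ.+-comm a (a ℕ.+ b))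

  -- Unlike `Valid`, this passes to the chain with its first vertex fixed without any change of
  -- weight, as the induction in `D-tup` requires.
  RepFree : ∀ {k} → Fin n → Chain k → Set
  RepFree x c = ∀ ys → noRep (x ∷ ys) ≡ false → c (x ∷ ys) ≡ 0ℤ

  noRep-here : ∀ {k} x (ys : Vec (Fin n) k) → noRep (x ∷ x ∷ ys) ≡ false
  noRep-here x ys with x ≟ x
  ... | yes _ = refl
  ... | no ne = ⊥-elim (ne refl)

  noRep-there : ∀ {k} x y (ys : Vec (Fin n) k) → noRep (y ∷ ys) ≡ false → noRep (x ∷ y ∷ ys) ≡ false
  noRep-there x y ys h = trans (cong (not ⌊ x ≟ y ⌋ ∧_) h) (∧-zeroʳ _)

  -- The geodesic from x to `step x s` is unique unless s is `C`, and then there are two, one in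
  -- each direction. Their interior vertices correspond to the splittings of s.
  between-spl : ∀ {k} x s (w : Vec Letter k) (c : Chain (suc (suc k))) → RepFree x c → GoodL s →
    ΣF n (λ v → when (dist x v ℕ.+ dist v (step x s) ≡ᵇ dist x (step x s)) (c (x ∷ v ∷ tup (step x s) w)))
      ≡ spl s (λ v → c (tup x v)) w
  between-spl {k} x s w c rf gs = go s gs
    where
    c-tup : X (suc (suc k))
    c-tup v = c (tup x v)
    module B (s : Letter) (gs : GoodL s) = Between {x} {s} gs (λ v → c (x ∷ v ∷ tup (step x s) w))
      (rf _ (noRep-here x (tup (step x s) w)))
      (rf _ (noRep-there x (step x s) (tup (step x s) w) (noRep-here (step x s) (path (step x s) w))))
    near : ∀ s gs d p → step x s ≡ adv d x (suc p) → p ≤ M → wtL s ≡ suc p → ∀ j → j < p →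
      B.F s gs (step x (ℓ d j)) ≡ c (tup x (ℓ d j ∷ ℓ d (p ∸ suc j) ∷ w))
    near s gs d p e p≤M h j j<p = trans
      (B.F-near s gs (ℓ d j) (ℓ d (p ∸ suc j)) (ℕ.<-≤-trans j<p p≤M) (ℕ.<-≤-trans (∸-< j<p) p≤M)
        (trans (adv-split d x j<p p≤M) (sym e)) (trans (wt-split j<p) (sym h)))
      (cong (λ z → c (x ∷ step x (ℓ d j) ∷ tup z w)) (sym (trans (adv-split d x j<p p≤M) (sym e))))
    alg : ∀ a → 0ℤ + (a + (0ℤ + 0ℤ)) ≡ a
    alg = solve-∀
    go : ∀ s (gs : GoodL s) → ΣF n (B.F s gs) ≡ spl s c-tup w
    go (ℓ d p) gs = begin
      ΣF n F
        ≡⟨ ΣF-step d x F ⟩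
      F x + (Σ< M (λ j → F (step x (ℓ d j))) + (F (step x C) + Σ< M (λ j → F (step x (ℓ (not d) j)))))
        ≡⟨ cong₂ _+_ F-x (cong₂ _+_
             (trans (Σ<-truncate (λ j → F (step x (ℓ d j))) (ℕ.<⇒≤ gs) λ j p≤j j<M → F-far (ℓ d j) j<M (s≤s p≤j))
               (Σ<-cong p (near (ℓ d p) gs d p refl (ℕ.<⇒≤ gs) refl)))
             (cong₂ _+_ (F-far C tt (ℕ.≤-trans gs (ℕ.n≤1+n M)))
               (Σ<-zero M λ j j<M → F-false (step x (ℓ (not d) j)) (opposite d x j<M gs)))) ⟩
      0ℤ + (S d p c-tup w + (0ℤ + 0ℤ))
        ≡⟨ alg _ ⟩
      S d p c-tup w ∎
      where open B (ℓ d p) gs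
    go C gs = begin
      ΣF n F
        ≡⟨ ΣF-step false x F ⟩
      F x + (Σ< M (λ j → F (step x (ℓ false j))) + (F (step x C) + Σ< M (λ j → F (step x (ℓ true j)))))
        ≡⟨ cong₂ _+_ F-x (cong₂ _+_ (Σ<-cong M (near C gs false M refl ℕ.≤-refl refl))
             (cong₂ _+_ (F-far C tt ℕ.≤-refl) (Σ<-cong M (near C gs true M (sym (adv-m true x)) ℕ.≤-refl refl)))) ⟩
      0ℤ + (S false M c-tup w + (0ℤ + S true M c-tup w))
        ≡⟨ trans (+-identityˡ _) (cong (S false M c-tup w +_) (+-identityˡ _)) ⟩
      S false M c-tup w + S true M c-tup w ∎
      where open B C gs

  D-tup : ∀ {k} x (w : Vec Letter k) (c : Chain (suc k)) → RepFree x c → Good w →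
    D c (tup x w) ≡ ∂ (λ v → c (tup x v)) w
  D-tup x []      c rf gw        = refl
  D-tup x (s ∷ w) c rf (gs , gw) = cong -_ (cong₂ _+_ (between-spl x s w c rf gs)
    (D-tup (step x s) w (λ z → c (x ∷ z)) (λ ys h → rf (step x s ∷ ys) (noRep-there x (step x s) ys h)) gw))

  ∂ᴹ-tup : ∀ k l (c : Chain (suc k)) → Valid (suc k) l c → ∀ x w → Good w →
    ∂ᴹ k l c (tup x w) ≡ ∂ (λ v → c (tup x v)) w
  ∂ᴹ-tup k l c valid x w gw = trans (∂≡D k l c valid (tup x w))
    (D-tup x w c (λ ys h → valid (x ∷ ys) (cong (_∧ (len (x ∷ ys) ≡ᵇ l)) h)) gw)

  pull : ∀ {k} → Chain k → Fin n → X k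
  pull c x w = c (tup x w)

  -- The mask `gen` discards tuples with repetitions, where `dec` returns junk, and the part of u in
  -- other weights.
  push : ∀ {k} → ℕ → (Fin n → X k) → Chain k
  push {k} l u (x ∷ ys) = when (gen k l (x ∷ ys)) (u x (dec x ys))

  push-valid : ∀ {k} l (u : Fin n → X k) → Valid k l (push l u)
  push-valid l u (x ∷ ys) h = cong (λ b → when b (u x (dec x ys))) h

  pull-push : ∀ {k} l (u : Fin n → X k) x → Agree l (pull (push l u) x) (u x)
  pull-push l u x w gw e = cong₂ when
    (trans (gen-tup l x w gw) (≡ᵇ-refl e)) (cong (u x) (dec-path x w gw))

  valid-supp : ∀ {k l} {c : Chain k} → Valid k l c → ∀ x → Supp l (pull c x)
  valid-supp {l = l} valid x w gw ne = valid (tup x w) (trans (gen-tup l x w gw) (≡ᵇ-≢ ne))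

  -- Every generator is `tup x w` for a good word w of weight l, so these words determine a valid
  -- chain.
  valid-ext : ∀ {k l} {c c′ : Chain k} → Valid k l c → Valid k l c′ →
    (∀ x → Agree l (pull c x) (pull c′ x)) → ∀ y → c y ≡ c′ y
  valid-ext {k} {l} {c} {c′} valid valid′ h (x ∷ ys) with gen k l (x ∷ ys) in g
  ... | false = trans (valid (x ∷ ys) g) (sym (valid′ (x ∷ ys) g))
  ... | true with ∧-true g
  ...   | nr , lx with path-dec x ys nr
  ...     | gw , e = subst (λ z → c (x ∷ z) ≡ c′ (x ∷ z)) e
    (h x (dec x ys) gw (trans (sym (len-tup x (dec x ys) gw)) (trans (cong (λ z → len (x ∷ z)) e)
      (ℕ.≡ᵇ⇒≡ (len (x ∷ ys)) l (subst IsTrue (sym lx) tt)))))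

  cycle-valid : ∀ k l {c} → IsCycle k l c → Valid k l c
  cycle-valid zero    l cyc = cyc
  cycle-valid (suc k) l cyc = proj₁ cyc

  cycle-pull : ∀ k l {c} → IsCycle k l c → ∀ x → Cyc (pull c x)
  cycle-pull zero    l cyc x = tt
  cycle-pull (suc k) l {c} (valid , cyc) x w gw = trans (sym (∂ᴹ-tup k l c valid x w gw)) (cyc (tup x w))

  pull-cycle : ∀ k l {c} → Valid k l c → (∀ x → Cyc (pull c x)) → IsCycle k l c
  pull-cycle zero    l valid cyc = valid
  pull-cycle (suc k) l {c} valid cyc = valid ,
    valid-ext (∂-valid dist-self dist-pos k l c) (λ _ _ → refl)
      (λ x w gw _ → trans (∂ᴹ-tup k l c valid x w gw) (cyc x w gw))

  γ-boundary : ∀ k l {c} → IsBoundary k l c → ∀ x (i : Idx k l) → γ k i (pull c x) ≡ 0ℤ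
  γ-boundary k l {c} (w , valid , eq) x i = trans
    (γ-cong k i λ v gv → trans (sym (eq (tup x v))) (∂ᴹ-tup k l w valid x v gv))
    (γ-∂ k i (pull w x))

  -- The chains produced by `bound` need not be homogeneous. Passing through `push l` keeps only
  -- their weight l part, which suffices because `∂` preserves weight.
  boundary : ∀ k l {c} → Valid k l c → (∀ x → Cyc (pull c x)) →
    (∀ x (i : Idx k l) → γ k i (pull c x) ≡ 0ℤ) → IsBoundary k l c
  boundary k l {c} valid cyc h = push l u , push-valid l u ,
    valid-ext (∂-valid dist-self dist-pos k l (push l u)) valid eq
    where
    bd : ∀ x → Bd (pull c x)
    bd x = bound k (pull c x) (cyc x) (valid-supp valid x) (h x)
    u : Fin n → X (suc k)
    u x = proj₁ (bd x)
    eq : ∀ x → Agree l (pull (∂ᴹ k l (push l u)) x) (pull c x)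
    eq x w gw refl = begin
      ∂ᴹ k l (push l u) (tup x w)  ≡⟨ ∂ᴹ-tup k l (push l u) (push-valid l u) x w gw ⟩
      ∂ (pull (push l u) x) w      ≡⟨ ∂-agree w gw (pull-push l u x) ⟩
      ∂ (u x) w                    ≡⟨ proj₂ (bd x) w gw ⟩
      c (tup x w) ∎

  module _ {k} (φ : X k → ℤ) (φ-⊕ : ∀ c c′ → φ (c ⊕ c′) ≡ φ c + φ c′) (φ-⊙ : ∀ a c → φ (a ⊙ c) ≡ a * φ c) where

    linear-Σ : ∀ {A : Set} (js : List A) (a : A → ℤ) (c : A → X k) →
      φ (λ w → ΣL js (λ j → a j * c j w)) ≡ ΣL js (λ j → a j * φ (c j))
    linear-Σ []       a c = trans (φ-⊙ 0ℤ 𝟎) (*-zeroˡ (φ 𝟎))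
    linear-Σ (j ∷ js) a c = trans (φ-⊕ (a j ⊙ c j) (λ w → ΣL js (λ j → a j * c j w)))
      (cong₂ _+_ (φ-⊙ (a j) (c j)) (linear-Σ js a c))

  γ-lin : ∀ k {l} (i : Idx k l) r a z x → γ k i (pull (lin r a z) x) ≡ ΣF r (λ j → a j * γ k i (pull (z j) x))
  γ-lin k i r a z x = linear-Σ (γ k i) (γ-⊕ k i) (γ-⊙ k i) (allFin r) a (λ j → pull (z j) x)

  lin-cycle : ∀ k l r a (z : Fin r → Chain k) → (∀ i → IsCycle k l (z i)) →
    Valid k l (lin r a z) × (∀ x → Cyc (pull (lin r a z) x))
  lin-cycle k l r a z cyc = valid , cyc′ k z cyc
    where
    valid : Valid k l (lin r a z)
    valid y h = ΣL-zero (allFin r) λ i → trans (cong (a i *_) (cycle-valid k l (cyc i) y h)) (*-zeroʳ (a i))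
    cyc′ : ∀ k (z : Fin r → Chain k) → (∀ i → IsCycle k l (z i)) → ∀ x → Cyc (pull (lin r a z) x)
    cyc′ zero    z cyc x = tt
    cyc′ (suc k) z cyc x w gw = trans
      (linear-Σ (λ c → ∂ c w) (λ c c′ → ∂-⊕ c c′ w) (λ b c → ∂-⊙ b c w) (allFin r) a (λ j → pull (z j) x))
      (ΣL-zero (allFin r) λ j → trans (cong (a j *_) (cycle-pull (suc k) l (cyc j) x w gw)) (*-zeroʳ (a j)))

  -- Torsion-freeness and rank

  -- The functionals are linear with values in Z, where a nonzero factor can be cancelled.
  torsionFree : ∀ k l → MHTorsionFree k l
  torsionFree k l z cyc a a≢0 bd = boundary k l (cycle-valid k l cyc) (cycle-pull k l cyc) γ≡0
    where
    γ≡0 : ∀ x (i : Idx k l) → γ k i (pull z x) ≡ 0ℤ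
    γ≡0 x i with i*j≡0⇒i≡0∨j≡0 a (trans (sym (γ-⊙ k i a (pull z x))) (γ-boundary k l bd x i))
    ... | inj₁ a≡0 = ⊥-elim (a≢0 a≡0)
    ... | inj₂ e   = e

  module Generators (1≤N : 1 ≤ N) (k l : ℕ) where

    at : Fin n → Idx k l → Fin n → X k
    at x i x′ w = when ⌊ x′ ≟ x ⌋ (proj₁ (ζ k i) w)

    generator : Fin n → Idx k l → Chain k
    generator x i = push l (at x i)

    generator-cycle : ∀ x i → IsCycle k l (generator x i)
    generator-cycle x i = pull-cycle k l (push-valid l (at x i)) (cyc k (at x i) at-cyc)
      where
      at-cyc : ∀ x′ → Cyc (at x i x′)
      at-cyc x′ with x′ ≟ x
      ... | yes _ = proj₂ (ζ k i)
      ... | no  _ = Cyc-𝟎 k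
        where
        Cyc-𝟎 : ∀ k → Cyc (𝟎 {k})
        Cyc-𝟎 zero    = tt
        Cyc-𝟎 (suc k) w _ = ∂-𝟎 w
      cyc : ∀ k (u : Fin n → X k) → (∀ x → Cyc (u x)) → ∀ x → Cyc (pull (push l u) x)
      cyc zero    u h x = tt
      -- The differential at w reads only words of weight `wt w`, of which the mask keeps all or
      -- none.
      cyc (suc k) u h x w gw with wt w ℕ.≟ l
      ... | yes refl = trans (∂-agree w gw (pull-push l u x)) (h x w gw)
      ... | no ne    = trans
        (∂-agree {c′ = 𝟎} w gw λ v gv e → valid-supp (push-valid l u) x v gv λ e′ → ne (trans (sym e) e′))
        (∂-𝟎 w)

    γ-generator : ∀ x′ (i′ : Idx k l) x i →
      γ k i′ (pull (generator x i) x′) ≡ γ k i′ (at x i x′)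
    γ-generator x′ i′ x i = γ-agree k i′ (pull-push l (at x i) x′)

    γ-generator-same : ∀ x i → γ k i (pull (generator x i) x) ≡ 1ℤ
    γ-generator-same x i = trans (γ-generator x i x i) (trans (γ-cong k i at≡) (γ-ζ-same k i))
      where
      at≡ : at x i x ≈ proj₁ (ζ k i)
      at≡ w _ with x ≟ x
      ... | yes _ = refl
      ... | no ne = ⊥-elim (ne refl)

    γ-generator-diff : ∀ x′ i′ x i → (x′ , i′) ≢ (x , i) → γ k i′ (pull (generator x i) x′) ≡ 0ℤ
    γ-generator-diff x′ i′ x i ne = trans (γ-generator x′ i′ x i) lem
      where
      lem : γ k i′ (at x i x′) ≡ 0ℤ
      lem with x′ ≟ x
      ... | yes refl = γ-ζ-diff 1≤N k i′ i λ { refl → ne refl }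
      ... | no  _    = trans (γ-⊙ k i′ 0ℤ 𝟎) (*-zeroˡ (γ k i′ 𝟎))

    -- The matrix of `Γ` on the generators is the identity, whence independence. Conversely, r + 1
    -- cycles give r + 1 vectors in Z^r; a relation between these vectors is a combination of the
    -- cycles killed by every functional, hence a boundary.
    rank : ∀ {r} → Fin r ↔ (Fin n × Idx k l) → MHRank k l r
    rank {r} iso = (z , z-cycle , independent) , spanning
      where
      open Inverse iso using (to; from; strictlyInverseˡ; strictlyInverseʳ)
      z : Fin r → Chain k
      z j = generator (proj₁ (to j)) (proj₂ (to j))
      z-cycle : ∀ j → IsCycle k l (z j)
      z-cycle j = generator-cycle (proj₁ (to j)) (proj₂ (to j))
      Γ : Fin r → Chain k → ℤ
      Γ j c = γ k (proj₂ (to j)) (pull c (proj₁ (to j)))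
      Γ-z : ∀ i j → Γ i (z j) ≡ when ⌊ j ≟ i ⌋ 1ℤ
      Γ-z i j with j ≟ i
      ... | yes refl = γ-generator-same (proj₁ (to i)) (proj₂ (to i))
      ... | no ne    = γ-generator-diff (proj₁ (to i)) (proj₂ (to i)) (proj₁ (to j)) (proj₂ (to j))
        λ e → ne (trans (sym (strictlyInverseʳ j)) (trans (cong from (sym e)) (strictlyInverseʳ i)))
      when-* : ∀ b a → a * when b 1ℤ ≡ when b a
      when-* true  a = *-identityʳ a
      when-* false a = *-zeroʳ a
      independent : ∀ a → IsBoundary k l (lin r a z) → ∀ i → a i ≡ 0ℤ
      independent a bd i = begin
        a i                                      ≡⟨ ΣF-delta r i a ⟨
        ΣF r (λ j → when ⌊ j ≟ i ⌋ (a j))        ≡⟨ ΣL-cong (allFin r) (λ j → trans (cong (a j *_) (Γ-z i j)) (when-* ⌊ j ≟ i ⌋ (a j))) ⟨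
        ΣF r (λ j → a j * Γ i (z j))             ≡⟨ γ-lin k (proj₂ (to i)) r a z (proj₁ (to i)) ⟨
        Γ i (lin r a z)                          ≡⟨ γ-boundary k l bd (proj₁ (to i)) (proj₂ (to i)) ⟩
        0ℤ ∎
      spanning : ∀ (z : Fin (suc r) → Chain k) → (∀ i → IsCycle k l (z i)) → _
      spanning z cyc with dependent r (λ i j → Γ j (z i))
      ... | a , nz , h = a , nz , boundary k l (proj₁ lc) (proj₂ lc) γ≡0
        where
        lc = lin-cycle k l (suc r) a z cyc
        Γ≡0 : ∀ j → Γ j (lin (suc r) a z) ≡ 0ℤ
        Γ≡0 j = trans (γ-lin k (proj₂ (to j)) (suc r) a z (proj₁ (to j))) (h j)
        γ≡0 : ∀ x (i : Idx k l) → γ k i (pull (lin (suc r) a z) x) ≡ 0ℤ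
        γ≡0 x i = subst (λ p → γ k (proj₂ p) (pull (lin (suc r) a z) (proj₁ p)) ≡ 0ℤ)
          (strictlyInverseˡ (x , i)) (Γ≡0 (from (x , i)))

-- Solving the recursion for T and counting indices

module Counting (N : ℕ) where

  open import Data.Nat using (_*_)
  open Words N using (Idx; alt≢lift)

  down-≥ : ∀ {d l} f → d ≤ l → down d f l ≡ f (l ∸ d)
  down-≥ {d} {l} f d≤l with d ≤? l
  ... | yes _  = refl
  ... | no d≰l = ⊥-elim (d≰l d≤l)

  down-≱ : ∀ {d l} f → ¬ d ≤ l → down d f l ≡ 0
  down-≱ {d} {l} f d≰l with d ≤? l
  ... | yes d≤l = ⊥-elim (d≰l d≤l)
  ... | no _    = refl

  down-suc : ∀ f l → down 1 f (suc l) ≡ f l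
  down-suc f l = down-≥ f (s≤s z≤n)

  down-bound : ∀ {d l b} f → (∀ p → f p ≤ b) → down d f l ≤ b
  down-bound {d} {l} f h with d ≤? l
  ... | yes _ = h (l ∸ d)
  ... | no  _ = z≤n

  2m≤4m : ∀ m → 2 * m ≤ 4 * m
  2m≤4m m = ℕ.*-monoˡ-≤ m {2} {4} (s≤s (s≤s z≤n))

  T-bound : ∀ m k l → T m k l ≤ 4 * m
  T-bound m zero          zero    = 2m≤4m m
  T-bound m zero          (suc l) = z≤n
  T-bound m (suc zero)    zero          = z≤n
  T-bound m (suc zero)    (suc zero)    = ℕ.≤-refl
  T-bound m (suc zero)    (suc (suc l)) = z≤n
  T-bound m (suc (suc k)) l = ℕ.⊔-lub (down-bound {1} {l} (T m (suc k)) (T-bound m (suc k))) (down-bound {m} {l} (T m k) (T-bound m k))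

  -- The value 4m at (1, 1) is passed along the diagonal by the first argument of the maximum, and
  -- no entry of T exceeds it.
  T-diag : ∀ m k → T m (suc k) (suc k) ≡ 4 * m
  T-diag m zero    = refl
  T-diag m (suc k) = trans (cong (_⊔ down m (T m k) (suc (suc k))) (trans (down-suc (T m (suc k)) (suc k)) (T-diag m k)))
    (ℕ.m≥n⇒m⊔n≡m (down-bound {m} {suc (suc k)} (T m k) (T-bound m k)))

  T-one : ∀ m l → l ≢ 1 → T m 1 l ≡ 0
  T-one m zero          ne = refl
  T-one m (suc zero)    ne = ⊥-elim (ne refl)
  T-one m (suc (suc l)) ne = refl

  T-mono : ∀ m k p → T m k p ≤ T m (suc k) (suc p)
  T-mono m zero    zero    = 2m≤4m m
  T-mono m zero    (suc p) = z≤n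
  T-mono m (suc k) p       = ℕ.≤-trans (ℕ.≤-reflexive (sym (down-suc (T m (suc k)) p))) (ℕ.m≤m⊔n _ _)

  -- Off the diagonal the second argument of the maximum wins: the first is itself, by induction,
  -- zero or an entry of degree k - 1 moved by m, and entries do not decrease under (k, p) ↦ (k + 1,
  -- p + 1) by `T-mono`.
  T-off : ∀ m k l → l ≢ suc (suc k) → T m (suc (suc k)) l ≡ down m (T m k) l
  T-off-≤ : ∀ m k l → l ≢ suc k → T m (suc k) l ≤ down m (T m k) (suc l)
  T-off m k zero    ne = refl
  T-off m k (suc l) ne = ℕ.m≤n⇒m⊔n≡n (ℕ.≤-trans (ℕ.≤-reflexive (down-suc (T m (suc k)) l))
    (T-off-≤ m k l λ e → ne (cong suc e)))
  T-off-≤ m zero    l ne = ℕ.≤-trans (ℕ.≤-reflexive (T-one m l ne)) z≤n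
  T-off-≤ m (suc k) l ne = Sum.[ case-yes , case-no ]′ (toSum (m ≤? l))
    where
    case-no : ¬ m ≤ l → T m (suc (suc k)) l ≤ down m (T m (suc k)) (suc l)
    case-no m≰l = ℕ.≤-trans (ℕ.≤-reflexive (trans (T-off m k l ne) (down-≱ (T m k) m≰l))) z≤n
    case-yes : m ≤ l → T m (suc (suc k)) l ≤ down m (T m (suc k)) (suc l)
    case-yes m≤l = ℕ.≤-trans (ℕ.≤-reflexive (trans (T-off m k l ne) (down-≥ (T m k) m≤l)))
      (ℕ.≤-trans (T-mono m k (l ∸ m)) (ℕ.≤-reflexive (sym (trans (down-≥ (T m (suc k)) (ℕ.≤-trans m≤l (ℕ.n≤1+n l)))
        (cong (T m (suc k)) (ℕ.+-∸-assoc 1 m≤l))))))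

  Bool↔ : ∀ {A : Set} (f : Bool → A) → (∀ a → Σ Bool λ b → f b ≡ a) → (∀ {b c} → f b ≡ f c → b ≡ c) → Fin 2 ↔ A
  Bool↔ {A} f sur inj = mk↔ₛ′ to from to-from from-to
    where
    enc : Bool → Fin 2
    enc false = zero
    enc true  = suc zero
    to : Fin 2 → A
    to zero       = f false
    to (suc zero) = f true
    from : A → Fin 2
    from a = enc (proj₁ (sur a))
    to-enc : ∀ b → to (enc b) ≡ f b
    to-enc false = refl
    to-enc true  = refl
    to-from : ∀ a → to (from a) ≡ a
    to-from a = trans (to-enc (proj₁ (sur a))) (proj₂ (sur a))
    from-to : ∀ i → from (to i) ≡ i
    from-to zero       = cong enc (inj (proj₂ (sur (f false))))
    from-to (suc zero) = cong enc (inj (proj₂ (sur (f true))))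

  empty↔ : ∀ {A : Set} → ¬ A → Fin 0 ↔ A
  empty↔ ¬a = mk↔ₛ′ (λ ()) (λ a → ⊥-elim (¬a a)) (λ a → ⊥-elim (¬a a)) (λ ())

  m : ℕ
  m = suc (suc N)

  -- The factor 2m stands for the choice of a start vertex, r for the classes of words.
  Counted : ℕ → ℕ → ℕ → Set
  Counted t k l = Σ ℕ λ r → t ≡ 2 * m * r × (Fin r ↔ Idx k l)

  count-lift : ∀ k l → l ≢ suc (suc k) → (∀ l′ → Counted (T m k l′) k l′) → ∀ {t} → t ≡ down m (T m k) l →
    Dec (m ≤ l) → Counted t (suc (suc k)) l
  count-lift k l ne ih e (no m≰l) = 0 , trans e (trans (down-≱ (T m k) m≰l) (sym (ℕ.*-zeroʳ (2 * m)))) ,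
    empty↔ λ { (inj₁ (e , _)) → ne e ; (inj₂ (l′ , refl , _)) → m≰l (ℕ.m≤m+n m l′) }
  count-lift k l ne ih e (yes m≤l) with ih (l ∸ m)
  ... | r , eq , iso = r , trans e (trans (down-≥ (T m k) m≤l) eq) , mk↔ₛ′ to from to-from from-to
    where
    open Inverse iso using () renaming (to to f; from to g; strictlyInverseˡ to fg; strictlyInverseʳ to gf)
    l≡ : l ≡ m ℕ.+ (l ∸ m)
    l≡ = sym (ℕ.m+[n∸m]≡n m≤l)
    to : Fin r → Idx (suc (suc k)) l
    to i = inj₂ (l ∸ m , l≡ , f i)
    l∸m : ∀ {l′} → l ≡ m ℕ.+ l′ → l′ ≡ l ∸ m
    l∸m {l′} e = sym (trans (cong (_∸ m) e) (ℕ.m+n∸m≡n m l′))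
    from : Idx (suc (suc k)) l → Fin r
    from (inj₁ (e , _))      = ⊥-elim (ne e)
    from (inj₂ (l′ , e , i)) = g (subst (Idx k) (l∸m e) i)
    to-from : ∀ y → to (from y) ≡ y
    to-from (inj₁ (e , _)) = ⊥-elim (ne e)
    to-from (inj₂ (l′ , e , i)) with l∸m e
    ... | refl = cong₂ (λ e i → inj₂ (l ∸ m , e , i)) (ℕ.≡-irrelevant l≡ e) (fg i)
    from-to : ∀ i → from (to i) ≡ i
    from-to i with l∸m l≡
    ... | refl = gf i

  four : ∀ m → 4 * m ≡ 2 * m * 2
  four = ℕ-solve-∀

  count : 1 ≤ N → ∀ k l → Counted (T m k l) k l
  count 1≤N zero zero = 1 , sym (ℕ.*-identityʳ (2 * m)) ,
    mk↔ₛ′ (λ _ → refl) (λ _ → zero) (λ e → ℕ.≡-irrelevant refl e) (λ { zero → refl })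
  count 1≤N zero (suc l) = 0 , sym (ℕ.*-zeroʳ (2 * m)) , empty↔ λ ()
  count 1≤N (suc zero) l with l ℕ.≟ 1
  ... | yes refl = 2 , four m , Bool↔ (λ b → refl , b) (λ { (refl , b) → b , refl }) (λ { refl → refl })
  ... | no ne = 0 , trans (T-one m l ne) (sym (ℕ.*-zeroʳ (2 * m))) , empty↔ λ (e , _) → ne e
  count 1≤N (suc (suc k)) l with l ℕ.≟ suc (suc k)
  ... | yes refl = 2 , trans (T-diag m (suc k)) (four m) ,
    Bool↔ (λ b → inj₁ (refl , b))
      (λ { (inj₁ (refl , b)) → b , refl ; (inj₂ (_ , e , i)) → ⊥-elim (alt≢lift 1≤N k i e) }) (λ { refl → refl })
  ... | no ne = count-lift k l ne (count 1≤N k) (T-off m k l ne) (m ≤? l)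

open import Data.Nat using (_*_)

theorem4p8 : (m : ℕ) → 3 ≤ m →
    ((k l : ℕ) → MC.MHTorsionFree (2 * m) (cycleAdj (2 * m)) k l)
    × ((k l : ℕ) → MC.MHRank (2 * m) (cycleAdj (2 * m)) k l (T m k l))
theorem4p8 (suc (suc N)) (s≤s (s≤s 1≤N)) = torsionFree , λ k l →
  let r , T≡ , iso = Counting.count N 1≤N k l in
  subst (MC.MHRank (2 * m) (cycleAdj (2 * m)) k l) (sym T≡)
    (Generators.rank 1≤N k l (↔-trans *↔× (↔-refl ×-↔ iso)))
  where
  m = suc (suc N)
  open Tuples N (2 * m) (cong (m ℕ.+_) (ℕ.+-identityʳ m)) using (torsionFree; module Generators)
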